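{- Let $d \geq 1$ be an integer, let $N > 1$ be a composite integer and let $R = \mathbb{Z}/N\mathbb{Z}$. Consider the coefficient-choosing game of degree $d$ over $R$, where Wanda wins if and only if the final polynomial has a root in $R$. Then the player who makes the last move has a winning strategy when (1) $d$ is even, or (2) $d > 1$ and $N$ is cube-free, or (3) $d > 3$ and $N = 16 N_2$ for some cube-free odd integer $N_2$. In all other cases, Wanda has a winning strategy, whether she moves first or second.
   Context: The coefficient-choosing game of degree $d$ over a commutative ring $R$ with unity: two players, Nora and Wanda, alternately choose coefficients of a polynomial $f(x) = a_d x^d + \cdots + a_1 x + a_0$. On each move the player whose turn it is picks one coefficient $a_i$ that has not yet been chosen and assigns it a value in $R$. The leading coefficient $a_d$ and the constant coefficient $a_0$ must be nonzero. The game ends when all $d+1$ coefficients are chosen. Wanda wins if $f$ has a root in the ring of fractions $\operatorname{Frac}(R)$, and Nora wins otherwise. For $R = \mathbb{Z}/N\mathbb{Z}$, $\operatorname{Frac}(R) = R$. Who moves first is fixed in advance, which determines who makes the last (i.e. the $(d+1)$-st) move. "The last player has a winning strategy" means that whichever of the two players makes the last move has a winning strategy. -}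

module Defs where

open import Algebra.Bundles using (CommutativeRing)
import Algebra.Properties.Semiring.Exp as Exp
import Algebra.Properties.Semiring.Sum as Sum
open import Data.Fin.Base using (Fin; zero; fromℕ; toℕ)
open import Data.Integer.Base as ℤ using (ℤ; +_; 0ℤ; 1ℤ)
open import Data.Integer.Divisibility.Signed
  using (divides; ∣m∣n⇒∣m+n; ∣m⇒∣-m; ∣n⇒∣m*n) renaming (_∣_ to _∣ℤ_)
import Data.Integer.Properties as ℤ
open import Data.Integer.Tactic.RingSolver using (solve-∀)
open import Data.Maybe.Base using (Maybe; just; nothing)
open import Data.Nat.Base using (ℕ; zero; suc; _*_; _^_; _<_)
open import Data.Nat.Divisibility using (_∣_)
open import Data.Nat.Primality using (Prime)
open import Data.Product.Base using (∃-syntax; _×_; _,_)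
open import Data.Sum.Base using (_⊎_)
open import Data.Vec.Functional using (Vector; replicate; updateAt)
open import Function.Base using (const)
open import Level using (_⊔_; 0ℓ)
open import Relation.Binary.PropositionalEquality using (_≡_; refl; subst)
open import Relation.Nullary.Negation.Core using (¬_)

CubeFree : ℕ → Set
CubeFree n = ∀ {p} → Prime p → ¬ (p ^ 3 ∣ n)

infix 4 _≡_[mod_]

_≡_[mod_] : ℤ → ℤ → ℕ → Set
a ≡ b [mod N ] = + N ∣ℤ a ℤ.- b

-- The quotient is presented as a setoid: elements are integers, and
-- the ring equality is congruence modulo N.
ℤ/_ℤ : ℕ → CommutativeRing 0ℓ 0ℓ
ℤ/ N ℤ = record
  { Carrier = ℤ
  ; _≈_     = λ a b → a ≡ b [mod N ]
  ; _+_     = ℤ._+_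
  ; _*_     = ℤ._*_
  ; -_      = ℤ.-_
  ; 0#      = 0ℤ
  ; 1#      = 1ℤ
  ; isCommutativeRing = record
    { isRing = record
      { +-isAbelianGroup = record
        { isGroup = record
          { isMonoid = record
            { isSemigroup = record
              { isMagma = record
                { isEquivalence = record
                  { refl  = λ {a} → reflexive {a} refl
                  ; sym   = λ {a} {b} p → subst (+ N ∣ℤ_) (neg-diff a b) (∣m⇒∣-m p)
                  ; trans = λ {a} {b} {c} p q →
                      subst (+ N ∣ℤ_) (diff-trans a b c) (∣m∣n⇒∣m+n p q)
                  }
                ; ∙-cong = λ {a} {b} {c} {d} p q →
                    subst (+ N ∣ℤ_) (diff-+ a b c d) (∣m∣n⇒∣m+n p q)
                }
              ; assoc = λ a b c → reflexive (ℤ.+-assoc a b c)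
              }
            ; identity = (λ a → reflexive (ℤ.+-identityˡ a))
                       , (λ a → reflexive (ℤ.+-identityʳ a))
            }
          ; inverse = (λ a → reflexive (ℤ.+-inverseˡ a))
                    , (λ a → reflexive (ℤ.+-inverseʳ a))
          ; ⁻¹-cong = λ {a} {b} p →
              subst (+ N ∣ℤ_) (diff-neg a b) (∣m⇒∣-m p)
          }
        ; comm = λ a b → reflexive (ℤ.+-comm a b)
        }
      ; *-cong = λ {a} {b} {c} {d} p q →
          subst (+ N ∣ℤ_) (diff-* a b c d)
            (∣m∣n⇒∣m+n (∣n⇒∣m*n c p) (∣n⇒∣m*n b q))
      ; *-assoc = λ a b c → reflexive (ℤ.*-assoc a b c)
      ; *-identity = (λ a → reflexive (ℤ.*-identityˡ a))
                   , (λ a → reflexive (ℤ.*-identityʳ a))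
      ; distrib = (λ a b c → reflexive (ℤ.*-distribˡ-+ a b c))
                , (λ a b c → reflexive (ℤ.*-distribʳ-+ a b c))
      }
    ; *-comm = λ a b → reflexive (ℤ.*-comm a b)
    }
  }
  where
  reflexive : ∀ {a b} → a ≡ b → a ≡ b [mod N ]
  reflexive {a} refl = divides 0ℤ (ℤ.+-inverseʳ a)

  neg-diff : ∀ a b → ℤ.- (a ℤ.- b) ≡ b ℤ.- a
  neg-diff = solve-∀

  diff-trans : ∀ a b c → (a ℤ.- b) ℤ.+ (b ℤ.- c) ≡ a ℤ.- c
  diff-trans = solve-∀

  diff-+ : ∀ a b c d →
    (a ℤ.- b) ℤ.+ (c ℤ.- d) ≡ (a ℤ.+ c) ℤ.- (b ℤ.+ d)
  diff-+ = solve-∀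

  diff-neg : ∀ a b → ℤ.- (a ℤ.- b) ≡ (ℤ.- a) ℤ.- (ℤ.- b)
  diff-neg = solve-∀

  diff-* : ∀ a b c d →
    c ℤ.* (a ℤ.- b) ℤ.+ b ℤ.* (c ℤ.- d) ≡ a ℤ.* c ℤ.- b ℤ.* d
  diff-* = solve-∀

data Player : Set where
  nora wanda : Player

opponent : Player → Player
opponent nora  = wanda
opponent wanda = nora

-- Moves are numbered 0, …, d, and move 0 is made by the first player.
mover : Player → ℕ → Player
mover first zero    = first
mover first (suc k) = opponent (mover first k)

lastMover : ℕ → Player → Player
lastMover d first = mover first d

module Game {c ℓ} (R : CommutativeRing c ℓ) (d : ℕ) where

  open CommutativeRing R using (Carrier; _≈_; 0#; semiring)
    renaming (_*_ to _*ᴿ_)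
  open Exp semiring using () renaming (_^_ to _^ᴿ_)
  open Sum semiring using (sum⁺-syntax)

  -- The entry at index i is the coefficient of xⁱ.
  Polynomial : Set c
  Polynomial = Vector Carrier (suc d)

  eval : Polynomial → Carrier → Carrier
  eval f x = ∑[ i ≤ d ] (f i *ᴿ x ^ᴿ toℕ i)

  -- Roots are sought in R itself, which agrees with the game played for
  -- roots in Frac(R) when R is its own ring of fractions, as ℤ/Nℤ is.
  HasRoot : Polynomial → Set (c ⊔ ℓ)
  HasRoot f = ∃[ x ] eval f x ≈ 0#

  Wins : Player → Polynomial → Set (c ⊔ ℓ)
  Wins wanda f = HasRoot f
  Wins nora  f = ¬ HasRoot f

  -- nothing marks a coefficient that has not been chosen yet.
  Position : Set c
  Position = Vector (Maybe Carrier) (suc d)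

  start : Position
  start = replicate (suc d) nothing

  _[_≔_] : Position → Fin (suc d) → Carrier → Position
  s [ i ≔ a ] = updateAt s i (const (just a))

  Legal : Position → Fin (suc d) → Carrier → Set (c ⊔ ℓ)
  Legal s i a = s i ≡ nothing × (i ≡ zero ⊎ i ≡ fromℕ d → ¬ a ≈ 0#)

  -- WinningStrategy P q s: a strategy tree by which P wins the game
  -- continued from position s with q to move.  At P's turns the tree
  -- prescribes a move, at the opponent's turns it branches over every
  -- legal move; a position is a leaf exactly when it is full.
  data WinningStrategy (P : Player) : Player → Position → Set (c ⊔ ℓ) where
    finished : ∀ {q s} (f : Polynomial) → (∀ i → s i ≡ just (f i)) →
               Wins P f → WinningStrategy P q s
    choose   : ∀ {s} (i : Fin (suc d)) (a : Carrier) → Legal s i a →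
               WinningStrategy P (opponent P) (s [ i ≔ a ]) →
               WinningStrategy P P s
    respond  : ∀ {s} → (∃[ i ] s i ≡ nothing) →
               (∀ i a → Legal s i a → WinningStrategy P P (s [ i ≔ a ])) →
               WinningStrategy P (opponent P) s

  HasWinningStrategy : (first P : Player) → Set (c ⊔ ℓ)
  HasWinningStrategy first P = WinningStrategy P first start

LastPlayerCase : (d N : ℕ) → Set
LastPlayerCase d N =
    2 ∣ d
  ⊎ (1 < d × CubeFree N)
  ⊎ (3 < d
      × ∃[ N₂ ] (N ≡ 16 * N₂ × CubeFree N₂ × ¬ 2 ∣ N₂))

{-# OPTIONS --safe #-}
module Submission where

-- If Wanda moves last, she sees to it that the last coefficient is one that may
-- be zero, and uses it to make 1 a root.
--
-- If Nora moves last, fix a prime p dividing N. Her last coefficient can always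
-- be chosen so that no x prime to p is a root modulo p, so she only has to make
-- sure beforehand that no multiple of p is a root modulo N. A constant
-- coefficient prime to p does this. Otherwise Wanda has chosen a₀ divisible by
-- the primes dividing N, and for cube-free N some p² divides N but not a₀, so
-- that a₁ = 0 suffices; when N = 16 N₂ and a₀ = 4 c, Nora sets a₁ = 0 and then
-- uses a₂ or a₃ to keep c + a₂ + 2 a₃ nonzero modulo 4.
--
-- In the remaining cases a power pᵏ with k ≥ 3 divides N exactly. Wanda starts
-- with an a₀ congruent to p²ᵐ modulo pᵏ and to 0 modulo N / pᵏ, where
-- 2m < k ≤ 2m + 2. Unless pᵐ divides a₁ there is a root near the root of the
-- linear part, so Nora must set a₁ = b pᵐ at once, and Wanda answers with an a₂
-- such as - (1 + b), which makes pᵐ an approximate root.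

open import Defs
open import Algebra.Bundles using (CommutativeRing)
import Algebra.Properties.Semiring.Exp as Exp
import Algebra.Properties.Semiring.Sum as Sum
open import Data.Fin.Base as Fin using (Fin; zero; suc; fromℕ; toℕ)
import Data.Fin.Properties as Fin
open import Data.Integer.Base as ℤ
  using (ℤ; +_; 0ℤ; 1ℤ; -1ℤ; _+_; _*_; _-_; -_; _^_; ∣_∣)
open import Data.Integer.Divisibility.Signed
import Data.Integer.DivMod as ℤ
import Data.Integer.Properties as ℤ
open import Data.Integer.Tactic.RingSolver using (solve-∀)
open import Data.List.Base using ([]; _∷_)
open import Data.List.Relation.Unary.All using (_∷_)
open import Data.Maybe.Base using (Maybe; just; nothing; fromMaybe)
open import Data.Nat.Base as ℕ using (ℕ; zero; suc; _≤_; _<_; z≤n; s≤s)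
open import Data.Nat.Coprimality using (coprime-Bézout; prime⇒coprime)
import Data.Nat.Divisibility as ℕ
open import Data.Nat.GCD
  using (module Bézout; gcd; gcd[m,n]∣m; gcd[m,n]∣n; gcd-greatest)
open import Data.Nat.Induction using (<-wellFounded)
open import Data.Nat.ListAction using (product)
open import Data.Nat.Primality
  using (Composite; Prime; euclidsLemma; prime[2]; prime?; ¬prime[0]; ¬prime[1];
         ¬composite[0]; ¬composite[1]; composite⇒¬prime; prime⇒irreducible;
         prime⇒nonZero; prime⇒nonTrivial)
open import Data.Nat.Primality.Factorisation using (factorise; module PrimeFactorisation)
import Data.Nat.Properties as ℕ
import Data.Nat.Tactic.RingSolver as ℕ
open import Data.Product.Base using (∃-syntax; _×_; _,_; proj₁; proj₂)
open import Data.Sum.Base using (_⊎_; inj₁; inj₂; [_,_]′)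
open import Data.Vec.Functional as Vector using (Vector; updateAt)
open import Data.Vec.Functional.Properties
  using (updateAt-updates; updateAt-minimal)
open import Function.Base using (const; _∘_; id; case_of_)
open import Induction.WellFounded using (Acc; acc)
open import Relation.Binary.PropositionalEquality
  using (_≡_; _≢_; refl; sym; trans; cong; cong₂; subst; module ≡-Reasoning)
open import Relation.Nullary.Decidable using (Dec; yes; no; _×-dec_)
open import Relation.Nullary.Negation using (¬_; contradiction)

-- Counting the unchosen coefficients

module _ {a} {A : Set a} where

  hole : Maybe A → ℕ
  hole nothing  = 1
  hole (just _) = 0

  open? : (m : Maybe A) → m ≡ nothing ⊎ m ≢ nothing
  open? nothing  = inj₁ refl
  open? (just _) = inj₂ λ ()

  holes : ∀ {n} → Vector (Maybe A) n → ℕ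
  holes {zero}  s = 0
  holes {suc n} s = hole (s zero) ℕ.+ holes (s ∘ suc)

  holes-updateAt : ∀ {n} (s : Vector (Maybe A) n) i {v} → s i ≡ nothing →
                   holes s ≡ suc (holes (updateAt s i (const (just v))))
  holes-updateAt {suc n} s zero    e rewrite e = refl
  holes-updateAt {suc n} s (suc i) e =
    trans (cong (hole (s zero) ℕ.+_) (holes-updateAt (s ∘ suc) i e)) (ℕ.+-suc _ _)

  holes≡suc⇒∃ : ∀ {n k} (s : Vector (Maybe A) n) → holes s ≡ suc k →
                ∃[ i ] s i ≡ nothing
  holes≡suc⇒∃ {suc n} s e with s zero in s₀
  ... | nothing = zero , s₀
  ... | just _  = case holes≡suc⇒∃ (s ∘ suc) e of λ (i , sᵢ) → suc i , sᵢ

  holes≡0⇒just : ∀ {n} (s : Vector (Maybe A) n) → holes s ≡ 0 →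
                 ∀ v i → s i ≡ just (fromMaybe v (s i))
  holes≡0⇒just {suc n} s e v i with s zero in s₀
  holes≡0⇒just {suc n} s e v zero    | just x rewrite s₀ = refl
  holes≡0⇒just {suc n} s e v (suc i) | just x = holes≡0⇒just (s ∘ suc) e v i

  holes-replicate : ∀ n → holes {n} (const nothing) ≡ n
  holes-replicate zero    = refl
  holes-replicate (suc n) = cong suc (holes-replicate n)

  updateAt-nothing : ∀ {n} (s : Vector (Maybe A) n) i j {v} →
                     updateAt s i (const (just v)) j ≡ nothing → s j ≡ nothing
  updateAt-nothing s zero    (suc j) e = e
  updateAt-nothing s (suc i) zero    e = e
  updateAt-nothing s (suc i) (suc j) e = updateAt-nothing (s ∘ suc) i j e

mover-even : ∀ P n → mover P (n ℕ.* 2) ≡ P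
mover-even nora  zero    = refl
mover-even wanda zero    = refl
mover-even nora  (suc n) rewrite mover-even nora n = refl
mover-even wanda (suc n) rewrite mover-even wanda n = refl

-- Strategies over a general ring

module Play {c ℓ} (R : CommutativeRing c ℓ) (d : ℕ)
            (1≉0 : ¬ CommutativeRing._≈_ R (CommutativeRing.1# R)
                                            (CommutativeRing.0# R)) where

  open CommutativeRing R using (Carrier; 0#; 1#)
  open Game R d

  -- An open coefficient counts as zero, so that choosing it later adds a single monomial to the
  -- value.
  fill : Position → Polynomial
  fill s i = fromMaybe 0# (s i)

  infix 4 _⊑_

  -- A move only shrinks the set of completions `f` of `s`, so a statement about all completions
  -- survives every later move.
  _⊑_ : Position → Polynomial → Set c
  s ⊑ f = ∀ i {a} → s i ≡ just a → f i ≡ a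

  ⊑-fill : ∀ s → s ⊑ fill s
  ⊑-fill s i e rewrite e = refl

  ⊑-shrink : ∀ s {f} i {a} → s i ≡ nothing → s [ i ≔ a ] ⊑ f → s ⊑ f
  ⊑-shrink s {f} i sᵢ ext j {b} sⱼ with i Fin.≟ j
  ... | yes refl = case trans (sym sᵢ) sⱼ of λ ()
  ... | no i≢j   = ext j (trans (updateAt-minimal j i s (i≢j ∘ sym)) sⱼ)

  ⊑-at : ∀ s {f} i {a} → s [ i ≔ a ] ⊑ f → f i ≡ a
  ⊑-at s i ext = ext i (updateAt-updates i s)

  holes-move : ∀ s i {a k} → s i ≡ nothing → holes s ≡ suc k →
               holes (s [ i ≔ a ]) ≡ k
  holes-move s i sᵢ e = ℕ.suc-injective (trans (sym (holes-updateAt s i sᵢ)) e)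

  done : ∀ {P q s} → holes s ≡ 0 → Wins P (fill s) → WinningStrategy P q s
  done {s = s} e win = finished (fill s) (holes≡0⇒just s e 0#) win

  turn : ∀ P q → q ≡ P ⊎ q ≡ opponent P
  turn nora  nora  = inj₁ refl
  turn nora  wanda = inj₂ refl
  turn wanda nora  = inj₂ refl
  turn wanda wanda = inj₁ refl

  -- The outcome is settled, so `P` only has to keep moving; `1#` is legal at every open index
  -- because it is nonzero.
  sure : ∀ {P} n q s → holes s ≡ n → (∀ f → s ⊑ f → Wins P f) →
         WinningStrategy P q s
  sure         zero    q s e win = done e (win _ (⊑-fill s))
  sure {P} (suc n) q s e win with holes≡suc⇒∃ s e | turn P q
  ... | i , sᵢ | inj₁ refl = choose i 1# (sᵢ , const 1≉0)
          (sure n _ _ (holes-move s i sᵢ e) λ f → win f ∘ ⊑-shrink s i sᵢ)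
  ... | i , sᵢ | inj₂ refl = respond (i , sᵢ) λ j a (sⱼ , _) →
          sure n _ _ (holes-move s j sⱼ e) λ f → win f ∘ ⊑-shrink s j sⱼ

  -- With an odd number of holes on `P`'s turn, `P` also moves last. Until then `P` marks time by
  -- playing `1#`, and `finish` supplies the value for whichever hole remains.
  module LastMove {ℓ′} (P : Player) (Inv : Position → Set ℓ′)
    (preserved : ∀ s i {a} → s i ≡ nothing → Inv s → Inv (s [ i ≔ a ]))
    (finish : ∀ s i → s i ≡ nothing → Inv s →
              ∃[ a ] (Legal s i a × Wins P (fill (s [ i ≔ a ])))) where

    mutual
      myTurn : ∀ n {s} → holes s ≡ suc (n ℕ.* 2) → Inv s → WinningStrategy P P s
      myTurn zero {s} e inv with holes≡suc⇒∃ s e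
      ... | i , sᵢ with finish s i sᵢ inv
      ...   | a , legal , win = choose i a legal (done (holes-move s i sᵢ e) win)
      myTurn (suc n) {s} e inv with holes≡suc⇒∃ s e
      ... | i , sᵢ = choose i 1# (sᵢ , const 1≉0)
                       (theirTurn n (holes-move s i sᵢ e) (preserved s i sᵢ inv))

      theirTurn : ∀ n {s} → holes s ≡ suc (suc (n ℕ.* 2)) → Inv s →
                  WinningStrategy P (opponent P) s
      theirTurn n {s} e inv = respond (holes≡suc⇒∃ s e) λ i a (sᵢ , _) →
        myTurn n (holes-move s i sᵢ e) (preserved s i sᵢ inv)

-- Polynomial values by Horner's scheme

horner : ∀ {n} → Vector ℤ n → ℤ → ℤ
horner {zero}  f x = 0ℤ
horner {suc n} f x = f zero + x * horner (λ i → f (suc i)) x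

module _ (N : ℕ) where
  open CommutativeRing (ℤ/ N ℤ) using (semiring)
  open Exp semiring using () renaming (_^_ to _^ᴿ_)
  open Sum semiring using (sum)

  -- The factor `c` is there for the induction: past the constant coefficient every power carries
  -- one more `x`, which `c * x` absorbs.
  sum≡horner : ∀ {n} (f g : Vector ℤ n) c x → (∀ i → g i ≡ c * x ^ᴿ toℕ i) →
               sum (λ i → f i * g i) ≡ c * horner f x
  sum≡horner {zero}  f g c x e = sym (ℤ.*-zeroʳ c)
  sum≡horner {suc n} f g c x e = begin
    f zero * g zero + sum (λ i → f (suc i) * g (suc i))
      ≡⟨ cong₂ (λ u v → f zero * u + v) (e zero)
           (sum≡horner (λ i → f (suc i)) (g ∘ suc) (c * x) x λ i →
             trans (e (suc i)) (sym (ℤ.*-assoc c x _))) ⟩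
    f zero * (c * 1ℤ) + c * x * horner (λ i → f (suc i)) x
      ≡⟨ lemma (f zero) c x _ ⟩
    c * (f zero + x * horner (λ i → f (suc i)) x) ∎
    where
    open ≡-Reasoning
    lemma : ∀ a c x h → a * (c * 1ℤ) + c * x * h ≡ c * (a + x * h)
    lemma = solve-∀

module _ {N d : ℕ} where
  open Game (ℤ/ N ℤ) d

  -- The term `- 0ℤ` comes from unfolding congruence to zero as divisibility of a difference.
  eval≡horner : ∀ f x → eval f x - 0ℤ ≡ horner f x
  eval≡horner f x = begin
    eval f x - 0ℤ   ≡⟨ ℤ.+-identityʳ _ ⟩
    eval f x        ≡⟨ sum≡horner N f _ 1ℤ x (λ i → sym (ℤ.*-identityˡ _)) ⟩
    1ℤ * horner f x ≡⟨ ℤ.*-identityˡ _ ⟩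
    horner f x      ∎
    where open ≡-Reasoning

  root : ∀ f x → + N ∣ horner f x → HasRoot f
  root f x p = x , subst (+ N ∣_) (sym (eval≡horner f x)) p

  root⁻¹ : ∀ f → HasRoot f → ∃[ x ] + N ∣ horner f x
  root⁻¹ f (x , p) = x , subst (+ N ∣_) (eval≡horner f x) p

horner-cong-mod : ∀ {n k} (f : Vector ℤ n) {x y} → k ∣ x - y →
                  k ∣ horner f x - horner f y
horner-cong-mod {zero}  f p = divides 0ℤ refl
horner-cong-mod {suc n} {k} f {x} {y} p =
  subst (k ∣_) (lemma (f zero) x y (horner (λ i → f (suc i)) x) (horner (λ i → f (suc i)) y))
    (∣m∣n⇒∣m+n (∣m⇒∣m*n _ p) (∣n⇒∣m*n y (horner-cong-mod (λ i → f (suc i)) p)))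
  where
  lemma : ∀ a x y u v → (x - y) * u + y * (u - v) ≡ (a + x * u) - (a + y * v)
  lemma = solve-∀

horner-updateAt : ∀ {n} (s : Vector (Maybe ℤ) n) i a x → s i ≡ nothing →
  horner (fromMaybe 0ℤ ∘ updateAt s i (const (just a))) x ≡
  horner (fromMaybe 0ℤ ∘ s) x + a * x ^ toℕ i
horner-updateAt {suc n} s zero    a x e rewrite e = lemma a _
  where
  lemma : ∀ a h → a + h ≡ (0ℤ + h) + a * 1ℤ
  lemma = solve-∀
horner-updateAt {suc n} s (suc i) a x e
  rewrite horner-updateAt (s ∘ suc) i a x e = lemma (fromMaybe 0ℤ (s zero)) a x _ (x ^ toℕ i)
  where
  lemma : ∀ c a x h y → c + x * (h + a * y) ≡ (c + x * h) + a * (x * y)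
  lemma = solve-∀

-- Divisibility and congruence to zero

0≡⇒∣ : ∀ {k n} → 0ℤ ≡ n → k ∣ n
0≡⇒∣ refl = divides 0ℤ refl

∣-neg⁻¹ : ∀ {k n} → k ∣ - n → k ∣ n
∣-neg⁻¹ {k} {n} p = subst (k ∣_) (ℤ.neg-involutive n) (∣m⇒∣-m p)

∤-+ : ∀ {k} m n → ¬ k ∣ m + n → (¬ k ∣ m) ⊎ (¬ k ∣ n)
∤-+ {k} m n k∤m+n with k ∣? m
... | no k∤m  = inj₁ k∤m
... | yes k∣m = inj₂ λ k∣n → k∤m+n (∣m∣n⇒∣m+n k∣m k∣n)

≈0⇒∣ : ∀ {N a} → a ≡ 0ℤ [mod N ] → + N ∣ a
≈0⇒∣ {N} {a} = subst (+ N ∣_) (ℤ.+-identityʳ a)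

∣⇒≈0 : ∀ {N a} → + N ∣ a → a ≡ 0ℤ [mod N ]
∣⇒≈0 {N} {a} = subst (+ N ∣_) (sym (ℤ.+-identityʳ a))

∤-small : ∀ {N} a .{{_ : ℕ.NonZero a}} → a < N → ¬ + N ∣ + a
∤-small a a<N p = ℕ.<⇒≱ a<N (ℕ.∣⇒≤ (∣⇒∣ᵤ p))

1≉0 : ∀ {N} → 1 < N → ¬ 1ℤ ≡ 0ℤ [mod N ]
1≉0 1<N = ∤-small 1 1<N ∘ ≈0⇒∣

-- Wanda moves last

module WandaLast {N d : ℕ} (1<N : 1 < N) where
  open Game (ℤ/ N ℤ) d
  open Play (ℤ/ N ℤ) d (1≉0 1<N)

  Corner : Fin (suc d) → Set
  Corner k = k ≡ zero ⊎ k ≡ fromℕ d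

  -- Once both corners are chosen, every remaining coefficient may be zero, so a forced value is
  -- always legal.
  Closed : Position → Set
  Closed s = ∀ k → Corner k → s k ≢ nothing

  ClosedExcept : Fin (suc d) → Position → Set
  ClosedExcept i s = ∀ k → Corner k → s k ≡ nothing → k ≡ i

  -- All powers of 1 are 1, so the last coefficient, whatever its index, just has to cancel the
  -- value `h` of the rest at 1.
  finish : ∀ s i → s i ≡ nothing → Closed s →
           ∃[ a ] (Legal s i a × HasRoot (fill (s [ i ≔ a ])))
  finish s i sᵢ closed = - h , (sᵢ , λ corner → contradiction sᵢ (closed i corner)) ,
    root (fill (s [ i ≔ - h ])) 1ℤ (0≡⇒∣ (sym (begin
      horner (fill (s [ i ≔ - h ])) 1ℤ ≡⟨ horner-updateAt s i (- h) 1ℤ sᵢ ⟩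
      h + - h * 1ℤ ^ toℕ i             ≡⟨ cong (λ u → h + - h * u) (ℤ.^-zeroˡ (toℕ i)) ⟩
      h + - h * 1ℤ                     ≡⟨ lemma h ⟩
      0ℤ                               ∎)))
    where
    open ≡-Reasoning
    h : ℤ
    h = horner (fill s) 1ℤ
    lemma : ∀ h → h + - h * 1ℤ ≡ 0ℤ
    lemma = solve-∀

  open LastMove wanda Closed
    (λ s i sᵢ closed k corner sₖ → closed k corner (updateAt-nothing s i k sₖ))
    finish public

  doneAt : ∀ {q s} x → holes s ≡ 0 → 0ℤ ≡ horner (fill s) x →
           WinningStrategy wanda q s
  doneAt {s = s} x e r = done e (root (fill s) x (0≡⇒∣ r))

  -- Wanda has a move to spare before the last one and spends it on the only corner that can be
  -- open.
  closedExcept⇒wins : ∀ n i {s} → holes s ≡ 3 ℕ.+ n ℕ.* 2 → ClosedExcept i s →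
                      WinningStrategy wanda wanda s
  closedExcept⇒wins n i {s} e closed with open? (s i)
  ... | inj₂ sᵢ≢ = myTurn (suc n) e λ k corner sₖ →
          sᵢ≢ (subst (λ j → s j ≡ nothing) (closed k corner sₖ) sₖ)
  ... | inj₁ sᵢ = choose i 1ℤ (sᵢ , const (1≉0 1<N))
          (theirTurn n (holes-move s i sᵢ e) λ k corner sₖ →
            case closed k corner (updateAt-nothing s i k sₖ) of λ where
              refl → case trans (sym sₖ) (updateAt-updates i s) of λ ())

  -- Wanda has two moves to spare before the last one, enough for both corners.
  fiveHoles⇒wins : ∀ n {s} → holes s ≡ 5 ℕ.+ n ℕ.* 2 → WinningStrategy wanda wanda s
  fiveHoles⇒wins n {s} e with open? (s zero)
  ... | inj₂ s₀≢ = closedExcept⇒wins (suc n) (fromℕ d) e λ where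
          k (inj₁ refl) sₖ → contradiction sₖ s₀≢
          k (inj₂ refl) sₖ → refl
  ... | inj₁ s₀ = choose zero 1ℤ (s₀ , const (1≉0 1<N))
          (respond (holes≡suc⇒∃ s′ e′) λ i a (sᵢ , _) →
            closedExcept⇒wins n (fromℕ d) (holes-move s′ i sᵢ e′) λ where
              k (inj₁ refl) sₖ → case updateAt-nothing s′ i k sₖ of λ ()
              k (inj₂ refl) sₖ → refl)
    where
    s′ : Position
    s′ = s [ zero ≔ 1ℤ ]
    e′ : holes s′ ≡ 4 ℕ.+ n ℕ.* 2
    e′ = holes-move s zero {1ℤ} s₀ e

wins-degree-1 : ∀ {N} → 1 < N → Game.HasWinningStrategy (ℤ/ N ℤ) 1 nora wanda
wins-degree-1 {N} 1<N = respond (zero , refl) λ where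
    zero       a (_ , a≉0) → choose (suc zero) (- a) (refl , λ _ → neg≉0 a (a≉0 (inj₁ refl)))
                               (doneAt 1ℤ refl (zeroˡ a))
    (suc zero) a (_ , a≉0) → choose zero (- a) (refl , λ _ → neg≉0 a (a≉0 (inj₂ refl)))
                               (doneAt 1ℤ refl (zeroʳ a))
  where
  open Game (ℤ/ N ℤ) 1
  open WandaLast {N} {1} 1<N using (doneAt)
  neg≉0 : ∀ a → ¬ a ≡ 0ℤ [mod N ] → ¬ - a ≡ 0ℤ [mod N ]
  neg≉0 a a≉0 p = a≉0 (∣⇒≈0 {a = a} (∣-neg⁻¹ (≈0⇒∣ {a = - a} p)))
  zeroˡ : ∀ a → 0ℤ ≡ a + 1ℤ * (- a + 1ℤ * 0ℤ)
  zeroˡ = solve-∀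
  zeroʳ : ∀ a → 0ℤ ≡ - a + 1ℤ * (a + 1ℤ * 0ℤ)
  zeroʳ = solve-∀

-- In degrees 2 and 3 a corner coefficient may come last. Wanda then has the
-- choice between the roots 1 and -1, whose two forced values for that
-- coefficient do not both vanish because of her earlier move.
wins-degree-2 : ∀ {N} → 2 < N → Game.HasWinningStrategy (ℤ/ N ℤ) 2 wanda wanda
wins-degree-2 {N} 2<N = choose (suc (suc zero)) 1ℤ (refl , const (1≉0 1<N))
  (respond (zero , refl) λ where
    zero             a _        → myTurn 0 refl λ where
      k (inj₁ refl) ()
      k (inj₂ refl) ()
    (suc zero)       b _        → last b
    (suc (suc zero)) _ (() , _))
  where
  open Game (ℤ/ N ℤ) 2
  1<N : 1 < N
  1<N = ℕ.<-trans (ℕ.n<1+n 1) 2<N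
  open WandaLast {N} {2} 1<N using (doneAt; myTurn)
  sum₂ : ∀ b → (1ℤ + b) + (1ℤ - b) ≡ + 2
  sum₂ = solve-∀
  at1 : ∀ b → 0ℤ ≡ - (1ℤ + b) + 1ℤ * (b + 1ℤ * (1ℤ + 1ℤ * 0ℤ))
  at1 = solve-∀
  at-1 : ∀ b → 0ℤ ≡ - (1ℤ - b) + -1ℤ * (b + -1ℤ * (1ℤ + -1ℤ * 0ℤ))
  at-1 = solve-∀
  last : ∀ b → WinningStrategy wanda wanda
                 ((start [ suc (suc zero) ≔ 1ℤ ]) [ suc zero ≔ b ])
  -- Up to sign, the values forced by the roots 1 and -1 add up to 2, which is nonzero as `2 < N`.
  last b with ∤-+ {+ N} (1ℤ + b) (1ℤ - b) (∤-small 2 2<N ∘ subst (+ N ∣_) (sum₂ b))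
  ... | inj₁ ∤ = choose zero (- (1ℤ + b)) (refl , λ _ → ∤ ∘ ∣-neg⁻¹ ∘ ≈0⇒∣)
                   (doneAt 1ℤ refl (at1 b))
  ... | inj₂ ∤ = choose zero (- (1ℤ - b)) (refl , λ _ → ∤ ∘ ∣-neg⁻¹ ∘ ≈0⇒∣)
                   (doneAt -1ℤ refl (at-1 b))

wins-degree-3 : ∀ {N} → 2 < N → Game.HasWinningStrategy (ℤ/ N ℤ) 3 nora wanda
wins-degree-3 {N} 2<N = respond (zero , refl) λ where
    zero                   a _ → closedExcept⇒wins 0 (suc (suc (suc zero))) refl λ where
      k (inj₁ refl) ()
      k (inj₂ refl) _ → refl
    (suc zero)             b _ → case shift b of λ (t , t≉0 , ∤) →
      choose (suc (suc (suc zero))) t (refl , const t≉0) (respond (zero , refl) λ where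
        zero                   a _ → myTurn 0 refl λ where
          k (inj₁ refl) ()
          k (inj₂ refl) ()
        (suc zero)             _ (() , _)
        (suc (suc zero))       c _ → last₀ b c t ∤
        (suc (suc (suc zero))) _ (() , _))
    (suc (suc zero))       c _ → case shift c of λ (t , t≉0 , ∤) →
      choose zero t (refl , const t≉0) (respond (suc zero , refl) λ where
        zero                   _ (() , _)
        (suc zero)             b _ → last₃ b c t ∤
        (suc (suc zero))       _ (() , _)
        (suc (suc (suc zero))) a _ → myTurn 0 refl λ where
          k (inj₁ refl) ()
          k (inj₂ refl) ())
    (suc (suc (suc zero))) a _ → closedExcept⇒wins 0 zero refl λ where
      k (inj₁ refl) _ → refl
      k (inj₂ refl) ()
  where
  open Game (ℤ/ N ℤ) 3
  1<N : 1 < N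
  1<N = ℕ.<-trans (ℕ.n<1+n 1) 2<N
  open WandaLast {N} {3} 1<N using (doneAt; myTurn; closedExcept⇒wins)

  -- Up to sign, the two forced values add up to 2 (t + b), where `b` is Nora's coefficient. If 2 (1
  -- + b) vanishes, then 2 (2 + b) is congruent to 2.
  shift : ∀ b → ∃[ t ] (¬ t ≡ 0ℤ [mod N ] × ¬ + N ∣ (t + b) + (t + b))
  shift b with + N ∣? (1ℤ + b) + (1ℤ + b)
  ... | no ∤  = 1ℤ , 1≉0 1<N , ∤
  ... | yes p = + 2 , ∤-small 2 2<N ∘ ≈0⇒∣ , λ q →
                  ∤-small 2 2<N (∣m+n∣n⇒∣m (subst (+ N ∣_) (two b) q) p)
    where
    two : ∀ b → (+ 2 + b) + (+ 2 + b) ≡ + 2 + ((1ℤ + b) + (1ℤ + b))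
    two = solve-∀

  last₀ : ∀ b c t → ¬ + N ∣ (t + b) + (t + b) → WinningStrategy wanda wanda
    (((start [ suc zero ≔ b ]) [ suc (suc (suc zero)) ≔ t ]) [ suc (suc zero) ≔ c ])
  last₀ b c t ∤₂ with ∤-+ {+ N} (t + b + c) (t + b - c) (∤₂ ∘ subst (+ N ∣_) (double b c t))
    where
    double : ∀ b c t → (t + b + c) + (t + b - c) ≡ (t + b) + (t + b)
    double = solve-∀
  ... | inj₁ ∤ = choose zero (- (t + b + c)) (refl , λ _ → ∤ ∘ ∣-neg⁻¹ ∘ ≈0⇒∣)
                   (doneAt 1ℤ refl (at1 b c t))
    where
    at1 : ∀ b c t → 0ℤ ≡ - (t + b + c) + 1ℤ * (b + 1ℤ * (c + 1ℤ * (t + 1ℤ * 0ℤ)))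
    at1 = solve-∀
  ... | inj₂ ∤ = choose zero (t + b - c) (refl , λ _ → ∤ ∘ ≈0⇒∣)
                   (doneAt -1ℤ refl (at-1 b c t))
    where
    at-1 : ∀ b c t → 0ℤ ≡ (t + b - c) + -1ℤ * (b + -1ℤ * (c + -1ℤ * (t + -1ℤ * 0ℤ)))
    at-1 = solve-∀

  last₃ : ∀ b c t → ¬ + N ∣ (t + c) + (t + c) → WinningStrategy wanda wanda
    (((start [ suc (suc zero) ≔ c ]) [ zero ≔ t ]) [ suc zero ≔ b ])
  last₃ b c t ∤₂ with ∤-+ {+ N} (t + b + c) (t - b + c) (∤₂ ∘ subst (+ N ∣_) (double b c t))
    where
    double : ∀ b c t → (t + b + c) + (t - b + c) ≡ (t + c) + (t + c)
    double = solve-∀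
  ... | inj₁ ∤ = choose (suc (suc (suc zero))) (- (t + b + c)) (refl , λ _ → ∤ ∘ ∣-neg⁻¹ ∘ ≈0⇒∣)
                   (doneAt 1ℤ refl (at1 b c t))
    where
    at1 : ∀ b c t → 0ℤ ≡ t + 1ℤ * (b + 1ℤ * (c + 1ℤ * (- (t + b + c) + 1ℤ * 0ℤ)))
    at1 = solve-∀
  ... | inj₂ ∤ = choose (suc (suc (suc zero))) (t - b + c) (refl , λ _ → ∤ ∘ ≈0⇒∣)
                   (doneAt -1ℤ refl (at-1 b c t))
    where
    at-1 : ∀ b c t → 0ℤ ≡ t + -1ℤ * (b + -1ℤ * (c + -1ℤ * ((t - b + c) + -1ℤ * 0ℤ)))
    at-1 = solve-∀

wandaLast-even : ∀ {N} n → 2 < N →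
                 Game.HasWinningStrategy (ℤ/ N ℤ) (suc n ℕ.* 2) wanda wanda
wandaLast-even zero 2<N = wins-degree-2 2<N
wandaLast-even {N} (suc n) 2<N =
  fiveHoles⇒wins n (holes-replicate (5 ℕ.+ n ℕ.* 2))
  where
  open WandaLast {N} {suc (suc n) ℕ.* 2} (ℕ.<-trans (ℕ.n<1+n 1) 2<N)

wandaLast-odd : ∀ {N} n → 2 < N →
                Game.HasWinningStrategy (ℤ/ N ℤ) (suc (n ℕ.* 2)) nora wanda
wandaLast-odd zero       2<N = wins-degree-1 (ℕ.<-trans (ℕ.n<1+n 1) 2<N)
wandaLast-odd (suc zero) 2<N = wins-degree-3 2<N
wandaLast-odd {N} (suc (suc n)) 2<N = respond (zero , refl) λ i a (sᵢ , _) →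
  fiveHoles⇒wins n (holes-move start i sᵢ (holes-replicate (6 ℕ.+ n ℕ.* 2)))
  where
  open Game (ℤ/ N ℤ) (suc (suc (suc n) ℕ.* 2))
  1<N : 1 < N
  1<N = ℕ.<-trans (ℕ.n<1+n 1) 2<N
  open Play (ℤ/ N ℤ) (suc (suc (suc n) ℕ.* 2)) (1≉0 1<N)
  open WandaLast {N} {suc (suc (suc n) ℕ.* 2)} 1<N

-- Nora moves last

euclid : ∀ {p} → Prime p → ∀ a b → + p ∣ a * b → (+ p ∣ a) ⊎ (+ p ∣ b)
euclid {p} pr a b p∣ab
  with euclidsLemma ∣ a ∣ ∣ b ∣ pr (subst (p ℕ.∣_) (ℤ.abs-* a b) (∣⇒∣ᵤ p∣ab))
... | inj₁ p∣a = inj₁ (∣ᵤ⇒∣ p∣a)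
... | inj₂ p∣b = inj₂ (∣ᵤ⇒∣ p∣b)

∤1 : ∀ {p} → Prime p → ¬ + p ∣ 1ℤ
∤1 pr p∣1 = ¬prime[1] (subst Prime (ℕ.∣1⇒≡1 (∣⇒∣ᵤ p∣1)) pr)

euclid-^ : ∀ {p} → Prime p → ∀ a n → + p ∣ a ^ n → + p ∣ a
euclid-^ pr a zero    p∣1  = contradiction p∣1 (∤1 pr)
euclid-^ pr a (suc n) p∣aⁿ with euclid pr a (a ^ n) p∣aⁿ
... | inj₁ p∣a = p∣a
... | inj₂ p∣  = euclid-^ pr a n p∣

∣-resp-mod : ∀ {k x y} → k ∣ x - y → k ∣ x → k ∣ y
∣-resp-mod {k} {x} {y} p q =
  subst (k ∣_) (lemma x y) (∣m∣n⇒∣m-n q p)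
  where
  lemma : ∀ x y → x - (x - y) ≡ y
  lemma = solve-∀

∣-% : ∀ p .{{_ : ℕ.NonZero p}} x → + p ∣ x - + (x ℤ.%ℕ p)
∣-% p x = divides (x ℤ./ℕ p) (begin
  x - + (x ℤ.%ℕ p)
    ≡⟨ cong (_- + (x ℤ.%ℕ p)) (ℤ.a≡a%ℕn+[a/ℕn]*n x p) ⟩
  (+ (x ℤ.%ℕ p) + x ℤ./ℕ p * + p) - + (x ℤ.%ℕ p)
    ≡⟨ lemma (+ (x ℤ.%ℕ p)) _ ⟩
  x ℤ./ℕ p * + p ∎)
  where
  open ≡-Reasoning
  lemma : ∀ r y → (r + y) - r ≡ y
  lemma = solve-∀

^-cong-mod : ∀ {k x y} n → k ∣ x - y → k ∣ x ^ n - y ^ n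
^-cong-mod         zero    p = divides 0ℤ refl
^-cong-mod {k} {x} {y} (suc n) p =
  subst (k ∣_) (lemma x y (x ^ n) (y ^ n))
    (∣m∣n⇒∣m+n (∣m⇒∣m*n (x ^ n) p) (∣n⇒∣m*n y (^-cong-mod n p)))
  where
  lemma : ∀ x y u v → (x - y) * u + y * (u - v) ≡ x * u - y * v
  lemma = solve-∀

-- There are p values of the coefficient and only p - 1 nonzero residues x,
-- each of which is a root for a single value.
avoidUnits : ∀ {p} → Prime p → ∀ {m} (f : Vector ℤ m) i →
  ∃[ a ] (a < p × ∀ x → ¬ + p ∣ x → ¬ + p ∣ horner f x + + suc a * x ^ i)
avoidUnits {zero}  pr f i = contradiction pr ¬prime[0]
avoidUnits {suc r} pr f i = case Fin.all? bad? of λ where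
    (yes allBad) → case Fin.pigeonhole (ℕ.n<1+n r) (proj₁ ∘ allBad) of
      λ (a , b , a<b , same) → contradiction
        (collision a b (proj₁ (allBad a)) (ℕ.<⇒≤ a<b) (proj₂ (allBad a))
          (subst (λ y → + suc r ∣ value b y) (sym same) (proj₂ (allBad b))))
        (ℕ.<⇒≢ a<b)
    (no ¬allBad) → case Fin.¬∀⟶∃¬ _ Bad bad? ¬allBad of λ (a , ¬bad) →
      toℕ a , Fin.toℕ<n a , λ x p∤x p∣ → good a ¬bad x p∤x p∣
  where
  value : Fin (suc r) → Fin r → ℤ
  value a y = horner f (+ suc (toℕ y)) + + suc (toℕ a) * (+ suc (toℕ y)) ^ i

  Bad : Fin (suc r) → Set
  Bad a = ∃[ y ] + suc r ∣ value a y

  bad? : ∀ a → Dec (Bad a)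
  bad? a = Fin.any? λ y → + suc r ∣? value a y

  -- Subtracting the two values leaves the gap between the coefficients times a power of a residue
  -- prime to p, so p divides a gap smaller than p.
  collision : ∀ a b y → toℕ a ≤ toℕ b → + suc r ∣ value a y → + suc r ∣ value b y →
              toℕ a ≡ toℕ b
  collision a b y a≤b p∣a p∣b = ℕ.≤-antisym a≤b (ℕ.m∸n≡0⇒m≤n gap≡0)
    where
    gap : ℕ
    gap = toℕ b ℕ.∸ toℕ a
    h x : ℤ
    h = horner f (+ suc (toℕ y))
    x = (+ suc (toℕ y)) ^ i
    lemma : ∀ h u v w → (h + (u + v) * w) - (h + u * w) ≡ v * w
    lemma = solve-∀
    p∣gap : + suc r ∣ + gap
    p∣gap with euclid pr (+ gap) x
      (subst (+ suc r ∣_)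
        (trans (cong (λ u → (h + + suc u * x) - (h + + suc (toℕ a) * x)) (sym (ℕ.m+[n∸m]≡n a≤b)))
               (lemma h (+ suc (toℕ a)) (+ gap) x))
        (∣m∣n⇒∣m-n p∣b p∣a))
    ... | inj₁ p∣ = p∣
    ... | inj₂ p∣ = contradiction (euclid-^ pr _ i p∣)
                      (∤-small (suc (toℕ y)) (s≤s (Fin.toℕ<n y)))
    gap≡0 : gap ≡ 0
    gap≡0 with gap in e
    ... | zero  = refl
    ... | suc g = contradiction (subst (λ u → + suc r ∣ + u) e p∣gap)
                    (∤-small (suc g) (subst (ℕ._≤ suc r) (cong suc e)
                      (s≤s (ℕ.≤-trans (ℕ.m∸n≤m (toℕ b) (toℕ a)) (ℕ.≤-pred (Fin.toℕ<n b))))))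

  good : ∀ a → ¬ Bad a → ∀ x → ¬ + suc r ∣ x →
         ¬ + suc r ∣ horner f x + + suc (toℕ a) * x ^ i
  good a ¬bad x p∤x p∣ with x ℤ.%ℕ suc r | ℤ.n%ℕd<d x (suc r) | ∣-% (suc r) x
  ... | zero  | _       | p∣x-y = p∤x (subst (+ suc r ∣_) (ℤ.+-identityʳ x) p∣x-y)
  ... | suc y | s≤s y<r | p∣x-y = ¬bad (Fin.fromℕ< y<r ,
      subst (λ z → + suc r ∣ horner f (+ suc z) + + suc (toℕ a) * (+ suc z) ^ i)
        (sym (Fin.toℕ-fromℕ< y<r))
        (∣-resp-mod (subst (+ suc r ∣_)
          (lemma (horner f x) (horner f (+ suc y)) (+ suc (toℕ a)) (x ^ i) ((+ suc y) ^ i))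
          (∣m∣n⇒∣m+n (horner-cong-mod f p∣x-y)
                     (∣n⇒∣m*n (+ suc (toℕ a)) (^-cong-mod {x = x} i p∣x-y)))) p∣))
    where
    lemma : ∀ u v a w z → (u - v) + a * (w - z) ≡ (u + a * w) - (v + a * z)
    lemma = solve-∀

module NoraLast {N d p : ℕ} (1<N : 1 < N) (pr : Prime p) (p∣N : + p ∣ + N) (p<N : p < N) where
  open Game (ℤ/ N ℤ) d
  open Play (ℤ/ N ℤ) d (1≉0 1<N)

  -- Only multiples of p are excluded in advance, since `avoidUnits` deals with every other `x` at
  -- the last move.
  Safe : Position → Set
  Safe s = ∀ f → s ⊑ f → ∀ x → + p ∣ x → ¬ + N ∣ horner f x

  finish : ∀ s i → s i ≡ nothing → Safe s →
           ∃[ a ] (Legal s i a × ¬ HasRoot (fill (s [ i ≔ a ])))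
  finish s i sᵢ safe with avoidUnits pr (fill s) (toℕ i)
  -- The candidates are 1, ..., p and not 0, ..., p - 1: by `p < N` each is nonzero modulo N, hence
  -- legal even at a corner.
  ... | a , a<p , avoids = + suc a ,
      (sᵢ , λ _ → ∤-small (suc a) (ℕ.≤-<-trans a<p p<N) ∘ ≈0⇒∣) ,
      λ hasRoot → case root⁻¹ (fill (s [ i ≔ + suc a ])) hasRoot of λ (x , N∣) →
        case + p ∣? x of λ where
          (yes p∣x) → safe _ (⊑-shrink s i sᵢ (⊑-fill _)) x p∣x N∣
          (no p∤x)  → avoids x p∤x (subst (+ p ∣_) (horner-updateAt s i (+ suc a) x sᵢ)
                                      (∣-trans p∣N N∣))

  open LastMove nora Safe
    (λ s i sᵢ safe f ext → safe f (⊑-shrink s i sᵢ ext)) finish public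

  -- At a multiple of p, all terms but the constant one vanish modulo p.
  safe-unit : ∀ {s a} → ¬ + p ∣ a → (∀ f → s ⊑ f → f zero ≡ a) → Safe s
  safe-unit p∤a f₀ f ext x p∣x N∣ rewrite f₀ f ext =
    p∤a (∣m+n∣n⇒∣m (∣-trans p∣N N∣) (∣m⇒∣m*n (horner (λ i → f (suc i)) x) p∣x))

module _ {N d p : ℕ} (1<N : 1 < N) (pr : Prime p) (p∣N : + p ∣ + N) (p<N : p < N) where
  open Play (ℤ/ N ℤ) (suc d) (1≉0 1<N)
  open NoraLast {N} {suc d} 1<N pr p∣N p<N

  -- With the linear term gone, all terms but the constant one vanish modulo p² at multiples of p.
  safe-square : ∀ {s a} → + p * + p ∣ + N → ¬ + p * + p ∣ a →
    (∀ f → s ⊑ f → f zero ≡ a × f (suc zero) ≡ 0ℤ) → Safe s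
  safe-square {a = a} p²∣N p²∤a f₀₁ f ext x (divides q refl) N∣
    rewrite proj₁ (f₀₁ f ext) | proj₂ (f₀₁ f ext) =
    p²∤a (∣m+n∣n⇒∣m {n = rest} (∣-trans p²∣N N∣) (divides (q * q * h) (lemma q (+ p) h)))
    where
    h rest : ℤ
    h = horner (λ i → f (suc (suc i))) (q * + p)
    rest = q * + p * (0ℤ + q * + p * h)
    lemma : ∀ q p h → q * p * (0ℤ + q * p * h) ≡ q * q * h * (p * p)
    lemma = solve-∀

data Parity (x : ℤ) : Set where
  even : ∀ z → x ≡ z * + 2 → Parity x
  odd  : ∀ z → x ≡ 1ℤ + z * + 2 → Parity x

parity : ∀ x → Parity x
parity x with x ℤ.%ℕ 2 | ℤ.n%ℕd<d x 2 | ∣-% 2 x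
... | 0 | _ | divides z e = even z (trans (sym (ℤ.+-identityʳ x)) e)
... | 1 | _ | divides z e = odd z (trans (cancel x) (cong (λ u → 1ℤ + u) e))
  where
  cancel : ∀ y → y ≡ 1ℤ + (y - 1ℤ)
  cancel = solve-∀
... | suc (suc _) | s≤s (s≤s ()) | _

module _ {N d : ℕ} (1<N : 1 < N) (2∣N : + 2 ∣ + N) (2<N : 2 < N) where
  open Play (ℤ/ N ℤ) (3 ℕ.+ d) (1≉0 1<N)
  open NoraLast {N} {3 ℕ.+ d} 1<N prime[2] 2∣N 2<N

  -- On even x = 2y the polynomial is 4 (c + a₂ y² + 2 a₃ y³) modulo 16, where
  -- the bracket is c or c + a₂ + 2 a₃ modulo 4 according to the parity of y.
  safe-sixteen : ∀ {s} c → + 16 ∣ + N → ¬ + 4 ∣ c →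
    (∀ f → s ⊑ f → f zero ≡ + 4 * c × f (suc zero) ≡ 0ℤ ×
      ¬ + 4 ∣ c + f (suc (suc zero)) + + 2 * f (suc (suc (suc zero)))) → Safe s
  safe-sixteen {s} c 16∣N 4∤c cond f ext x (divides y refl) N∣
    with cond f ext
  ... | e₀ , e₁ , 4∤ rewrite e₀ | e₁ = notRoot (parity y)
    where
    a₂ a₃ h : ℤ
    a₂ = f (suc (suc zero))
    a₃ = f (suc (suc (suc zero)))
    h  = horner (λ i → f (suc (suc (suc (suc i))))) (y * + 2)

    scale : ∀ c y a₂ a₃ h →
      + 4 * c + y * + 2 * (0ℤ + y * + 2 * (a₂ + y * + 2 * (a₃ + y * + 2 * h))) ≡
      + 4 * (c + y * y * a₂ + + 2 * y * y * y * a₃ + y * y * y * y * h * + 4)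
    scale = solve-∀

    4∣ : + 4 ∣ c + y * y * a₂ + + 2 * y * y * y * a₃
    4∣ = ∣m+n∣n⇒∣m {n = y * y * y * y * h * + 4}
      (*-cancelˡ-∣ (+ 4) (subst (+ 16 ∣_) (scale c y a₂ a₃ h) (∣-trans 16∣N N∣)))
      (divides (y * y * y * y * h) refl)

    notRoot : ¬ Parity y
    notRoot (even z y≡) =
      4∤c (∣m+n∣n⇒∣m {n = z * z * (a₂ + + 4 * z * a₃) * + 4}
        (subst (+ 4 ∣_) (trans (cong (λ y → c + y * y * a₂ + + 2 * y * y * y * a₃) y≡)
                               (atEven c z a₂ a₃)) 4∣)
        (divides (z * z * (a₂ + + 4 * z * a₃)) refl))
      where
      atEven : ∀ c z a₂ a₃ →
        c + z * + 2 * (z * + 2) * a₂ + + 2 * (z * + 2) * (z * + 2) * (z * + 2) * a₃ ≡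
        c + z * z * (a₂ + + 4 * z * a₃) * + 4
      atEven = solve-∀
    notRoot (odd z y≡) =
      4∤ (∣m+n∣n⇒∣m {n = ((z * z + z) * a₂ + (+ 3 * z + + 6 * z * z + + 4 * z * z * z) * a₃) * + 4}
        (subst (+ 4 ∣_) (trans (cong (λ y → c + y * y * a₂ + + 2 * y * y * y * a₃) y≡)
                               (atOdd c z a₂ a₃)) 4∣)
        (divides ((z * z + z) * a₂ + (+ 3 * z + + 6 * z * z + + 4 * z * z * z) * a₃) refl))
      where
      atOdd : ∀ c z a₂ a₃ →
        c + (1ℤ + z * + 2) * (1ℤ + z * + 2) * a₂
          + + 2 * (1ℤ + z * + 2) * (1ℤ + z * + 2) * (1ℤ + z * + 2) * a₃ ≡
        c + a₂ + + 2 * a₃ + ((z * z + z) * a₂ + (+ 3 * z + + 6 * z * z + + 4 * z * z * z) * a₃) * + 4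
      atOdd = solve-∀

-- Nora's choice of the prime and her strategies

primeFactor : ∀ n → 1 < n → ∃[ p ] (Prime p × p ℕ.∣ n)
primeFactor n@(suc _) 1<n with factorise n
... | record { factors = []; isFactorisation = e } = contradiction e (ℕ.<⇒≢ 1<n ∘ sym)
... | record { factors = p ∷ ps; isFactorisation = e; factorsPrime = pr ∷ _ } =
  p , pr , subst (p ℕ.∣_) (sym e) (ℕ.m∣m*n (product ps))

-- Nora's use of compositeness: it makes her p candidate values nonzero modulo N.
primeDivisor< : ∀ {p N} .{{_ : ℕ.NonZero N}} → Composite N → Prime p → p ℕ.∣ N → p < N
primeDivisor< {p} {N} comp pr p∣N with ℕ.m≤n⇒m<n∨m≡n (ℕ.∣⇒≤ p∣N)
... | inj₁ p<N  = p<N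
... | inj₂ refl = contradiction pr (composite⇒¬prime comp)

-- How a prime p can witness that N does not divide a.
data Escape (N : ℕ) (a : ℤ) (p : ℕ) : Set where
  unit    : ¬ + p ∣ a → Escape N a p
  simple  : + p * + p ∣ + N → ¬ + p * + p ∣ a → Escape N a p
  sixteen : p ≡ 2 → + 16 ∣ + N → ∀ c → a ≡ + 4 * c → ¬ + 4 ∣ c → Escape N a p

-- The prime p is chosen to have smaller exponent in gcd(N, a) than in N.
escape : ∀ N a → 1 < N → ¬ + N ∣ a →
  (∀ {p} → Prime p → p ℕ.^ 3 ℕ.∣ N → p ≡ 2 × 16 ℕ.∣ N × ¬ 32 ℕ.∣ N) →
  ∃[ p ] (Prime p × p ℕ.∣ N × Escape N a p)
escape N a 1<N N∤a cubes with gcd[m,n]∣m N ∣ a ∣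
... | ℕ.divides k N≡k*g = fromPrime (primeFactor k (cofactor>1 k N≡k*g))
  where
  g : ℕ
  g = gcd N ∣ a ∣
  cofactor>1 : ∀ k → N ≡ k ℕ.* g → 1 < k
  cofactor>1 0 N≡0 = contradiction N≡0 (ℕ.m<n⇒n≢0 1<N)
  cofactor>1 1 N≡g = contradiction (∣ᵤ⇒∣ (subst (ℕ._∣ ∣ a ∣)
    (sym (trans N≡g (ℕ.*-identityˡ g))) (gcd[m,n]∣n N ∣ a ∣))) N∤a
  cofactor>1 (suc (suc _)) _ = s≤s (s≤s z≤n)

  fromPrime : ∃[ p ] (Prime p × p ℕ.∣ k) → ∃[ p ] (Prime p × p ℕ.∣ N × Escape N a p)
  fromPrime (p , pr , p∣k) = p , pr , p∣N , esc
    where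
    -- As p divides the cofactor N / g, any power of p that divides both N and `a`, and hence g,
    -- forces the next power to divide N.
    pg∣N : p ℕ.* g ℕ.∣ N
    pg∣N = subst (p ℕ.* g ℕ.∣_) (sym N≡k*g) (ℕ.*-monoˡ-∣ g p∣k)
    p∣N : p ℕ.∣ N
    p∣N = ℕ.∣-trans (ℕ.m∣m*n g) pg∣N
    p²≡ : + p * + p ≡ + (p ℕ.* p)
    p²≡ = sym (ℤ.pos-* p p)
    esc : Escape N a p
    esc with + p ∣? a
    ... | no p∤a = unit p∤a
    ... | yes p∣a with + p * + p ∣? a
    ...   | no p²∤a = simple (subst (_∣ + N) (sym p²≡) (∣ᵤ⇒∣ p²∣N)) p²∤a
      where
      p²∣N : p ℕ.* p ℕ.∣ N
      p²∣N = ℕ.∣-trans (ℕ.*-monoʳ-∣ p (gcd-greatest p∣N (∣⇒∣ᵤ p∣a))) pg∣N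
    ...   | yes p²∣a with cubes pr p³∣N
      where
      p²∣N : p ℕ.* p ℕ.∣ N
      p²∣N = ℕ.∣-trans (ℕ.*-monoʳ-∣ p (gcd-greatest p∣N (∣⇒∣ᵤ p∣a))) pg∣N
      p³∣N : p ℕ.^ 3 ℕ.∣ N
      p³∣N = ℕ.∣-trans (ℕ.*-monoʳ-∣ p
        (subst (ℕ._∣ g) (cong (p ℕ.*_) (sym (ℕ.*-identityʳ p)))
          (gcd-greatest p²∣N (∣⇒∣ᵤ (subst (_∣ a) p²≡ p²∣a))))) pg∣N
    ...     | refl , 16∣N , ¬32∣N with p²∣a
    -- If 4 divided `c`, then 16 would divide g and therefore 32 would divide N.
    ...       | divides c a≡c*4 = sixteen refl (∣ᵤ⇒∣ 16∣N) c (trans a≡c*4 (ℤ.*-comm c (+ 4))) λ 4∣c →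
                  ¬32∣N (ℕ.∣-trans (ℕ.*-monoʳ-∣ 2 (gcd-greatest 16∣N
                    (∣⇒∣ᵤ {+ 16} {a} (subst (+ 16 ∣_) (sym a≡c*4) (*-monoˡ-∣ (+ 4) 4∣c))))) pg∣N)

noraLast-even : ∀ {N} n → 1 < N → Composite N →
                Game.HasWinningStrategy (ℤ/ N ℤ) (suc n ℕ.* 2) nora nora
noraLast-even {N@(suc _)} n 1<N comp with primeFactor N 1<N
... | p , pr , p∣N = choose zero 1ℤ (refl , const (1≉0 1<N))
    (theirTurn n (holes-replicate (2 ℕ.+ n ℕ.* 2))
      (safe-unit (∤1 pr) λ f ext → ⊑-at start zero ext))
  where
  open Game (ℤ/ N ℤ) (suc n ℕ.* 2)
  open Play (ℤ/ N ℤ) (suc n ℕ.* 2) (1≉0 1<N)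
  open NoraLast {N} {suc n ℕ.* 2} 1<N pr (∣ᵤ⇒∣ p∣N) (primeDivisor< comp pr p∣N)

-- In degree at least 5 neither a₂ nor a₃ is a corner. If Wanda sets a₂, the choice a₃ = 0 or 1
-- moves c + a₂ + 2 a₃ by 2 modulo 4; otherwise a₂ = 1 - c makes it odd whatever a₃ is.
sixteen-reply : ∀ {N} n c → 2 < N → + 2 ∣ + N → + 16 ∣ + N → ¬ + 4 ∣ c →
  let open Game (ℤ/ N ℤ) (5 ℕ.+ n ℕ.* 2) in
  WinningStrategy nora wanda ((start [ zero ≔ + 4 * c ]) [ suc zero ≔ 0ℤ ])
sixteen-reply {N} n c 2<N 2∣N 16∣N 4∤c = respond (suc (suc zero) , refl) λ where
    zero _ (() , _)
    (suc zero) _ (() , _)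
    (suc (suc zero)) b _ → case steer b of λ (t , 4∤) →
      choose (suc (suc (suc zero))) t (refl , λ { (inj₁ ()) ; (inj₂ ()) })
        (theirTurn n (holes-replicate (2 ℕ.+ n ℕ.* 2))
          (safe-sixteen 1<N 2∣N 2<N c 16∣N 4∤c λ f ext →
            ext zero refl , ext (suc zero) refl ,
            4∤ ∘ subst (+ 4 ∣_) (cong₂ (λ u v → c + u + + 2 * v)
              (ext (suc (suc zero)) refl) (ext (suc (suc (suc zero))) refl))))
    (suc (suc (suc j))) b _ →
      choose (suc (suc zero)) (1ℤ - c) (refl , λ { (inj₁ ()) ; (inj₂ ()) })
        (theirTurn n
          (holes-move (s [ suc (suc (suc j)) ≔ b ]) (suc (suc zero)) {1ℤ - c} refl
            (holes-move s (suc (suc (suc j))) {b} refl (holes-replicate (4 ℕ.+ n ℕ.* 2))))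
          (safe-sixteen 1<N 2∣N 2<N c 16∣N 4∤c λ f ext →
            ext zero refl , ext (suc zero) refl ,
            steered (f (suc (suc (suc zero)))) ∘ subst (+ 4 ∣_)
              (cong (λ u → c + u + + 2 * f (suc (suc (suc zero))))
                (ext (suc (suc zero)) refl))))
  where
  1<N : 1 < N
  1<N = ℕ.<-trans (ℕ.n<1+n 1) 2<N
  open Game (ℤ/ N ℤ) (5 ℕ.+ n ℕ.* 2)
  open Play (ℤ/ N ℤ) (5 ℕ.+ n ℕ.* 2) (1≉0 1<N)
  open NoraLast {N} {5 ℕ.+ n ℕ.* 2} 1<N prime[2] 2∣N 2<N
  s : Position
  s = (start [ zero ≔ + 4 * c ]) [ suc zero ≔ 0ℤ ]

  steer : ∀ b → ∃[ t ] ¬ + 4 ∣ c + b + + 2 * t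
  steer b with + 4 ∣? c + b
  ... | no 4∤  = 0ℤ , 4∤ ∘ subst (+ 4 ∣_) (ℤ.+-identityʳ (c + b))
  ... | yes 4∣ = 1ℤ , λ q → ∤-small 2 (s≤s (s≤s (s≤s z≤n))) (∣m+n∣m⇒∣n q 4∣)

  steered : ∀ v → ¬ + 4 ∣ c + (1ℤ - c) + + 2 * v
  steered v q = ∤1 prime[2] (∣m+n∣n⇒∣m
    (subst (+ 2 ∣_) (lemma c v) (∣-trans (divides (+ 2) refl) q))
    (divides v refl))
    where
    lemma : ∀ c v → c + (1ℤ - c) + + 2 * v ≡ 1ℤ + v * + 2
    lemma = solve-∀

noraLast-odd : ∀ {N} n → 1 < N → Composite N →
  (∀ {p} → Prime p → p ℕ.^ 3 ℕ.∣ N → 0 < n × p ≡ 2 × 16 ℕ.∣ N × ¬ 32 ℕ.∣ N) →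
  Game.HasWinningStrategy (ℤ/ N ℤ) (3 ℕ.+ n ℕ.* 2) wanda nora
noraLast-odd {N@(suc _)} n 1<N comp cubes = respond (zero , refl) λ where
    zero    a (_ , a≉0) → afterConstant a (escape N a 1<N (a≉0 (inj₁ refl) ∘ ∣⇒≈0) λ pr → proj₂ ∘ cubes pr)
    (suc j) a _         → otherwise j a (primeFactor N 1<N)
  where
  open Game (ℤ/ N ℤ) (3 ℕ.+ n ℕ.* 2)
  open Play (ℤ/ N ℤ) (3 ℕ.+ n ℕ.* 2) (1≉0 1<N)

  otherwise : ∀ j a → ∃[ p ] (Prime p × p ℕ.∣ N) →
              WinningStrategy nora nora (start [ suc j ≔ a ])
  otherwise j a (p , pr , p∣N) = choose zero 1ℤ (refl , const (1≉0 1<N))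
      (theirTurn n (holes-move (start [ suc j ≔ a ]) zero {1ℤ} refl
                     (holes-move start (suc j) {a} refl (holes-replicate (4 ℕ.+ n ℕ.* 2))))
        (safe-unit (∤1 pr) λ f ext → ext zero refl))
    where
    open NoraLast {N} {3 ℕ.+ n ℕ.* 2} 1<N pr (∣ᵤ⇒∣ p∣N) (primeDivisor< comp pr p∣N)

  afterConstant : ∀ a → ∃[ p ] (Prime p × p ℕ.∣ N × Escape N a p) →
                  WinningStrategy nora nora (start [ zero ≔ a ])
  afterConstant a (p , pr , p∣N , unit p∤a) =
      myTurn (suc n) (holes-replicate (3 ℕ.+ n ℕ.* 2))
        (safe-unit p∤a λ f ext → ext zero refl)
    where
    open NoraLast {N} {3 ℕ.+ n ℕ.* 2} 1<N pr (∣ᵤ⇒∣ p∣N) (primeDivisor< comp pr p∣N)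
  afterConstant a (p , pr , p∣N , simple p²∣N p²∤a) =
      choose (suc zero) 0ℤ (refl , λ { (inj₁ ()) ; (inj₂ ()) })
        (theirTurn n (holes-replicate (2 ℕ.+ n ℕ.* 2))
          (safe-square 1<N pr (∣ᵤ⇒∣ p∣N) p<N p²∣N p²∤a
            λ f ext → ext zero refl , ext (suc zero) refl))
    where
    p<N : p < N
    p<N = primeDivisor< comp pr p∣N
    open NoraLast {N} {3 ℕ.+ n ℕ.* 2} 1<N pr (∣ᵤ⇒∣ p∣N) p<N
  afterConstant a (p , pr , p∣N , sixteen refl 16∣N c refl 4∤c) =
      choose (suc zero) 0ℤ (refl , λ { (inj₁ ()) ; (inj₂ ()) })
        (reply n (proj₁ (cubes pr (ℕ.∣-trans (ℕ.divides 2 refl) (∣⇒∣ᵤ 16∣N)))))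
    where
    reply : ∀ n → 0 < n → Game.WinningStrategy (ℤ/ N ℤ) (3 ℕ.+ n ℕ.* 2) nora wanda
      (updateAt (updateAt (const nothing) zero (const (just (+ 4 * c)))) (suc zero) (const (just 0ℤ)))
    reply (suc n) _ =
      sixteen-reply n c (primeDivisor< comp prime[2] p∣N) (∣ᵤ⇒∣ p∣N) 16∣N 4∤c

-- Roots modulo a prime power

-- If `u` inverts `b` modulo pᵏ and `v`, a Bézout coefficient up to sign, inverts it modulo p, then
-- 1 - (1 - b u)(1 - b v) is a multiple of `b` and the two errors multiply.
primePow-inverse : ∀ {p} → Prime p → ∀ k b → ¬ + p ∣ b → ∃[ u ] (+ p) ^ k ∣ b * u - 1ℤ
primePow-inverse         pr zero    b p∤b = 0ℤ , divides (b * 0ℤ - 1ℤ) (sym (ℤ.*-identityʳ _))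
primePow-inverse {p} pr (suc k) b p∤b
  with primePow-inverse pr k b p∤b | modPrime (b ℤ.%ℕ p) (ℤ.n%ℕd<d b p) (∣-% p b)
  where
  instance
    p≢0 : ℕ.NonZero p
    p≢0 = prime⇒nonZero pr

  1+-cancel : ∀ a b c d → + (1 ℕ.+ a ℕ.* b) ≡ + (c ℕ.* d) → 1ℤ + + a * + b ≡ + c * + d
  1+-cancel a b c d e =
    trans (cong (λ x → 1ℤ + x) (sym (ℤ.pos-* a b))) (trans e (ℤ.pos-* c d))

  modPrime : ∀ r → r < p → + p ∣ b - + r → ∃[ v ] + p ∣ b * v - 1ℤ
  modPrime zero    _   p∣ = contradiction (subst (+ p ∣_) (ℤ.+-identityʳ b) p∣) p∤b
  modPrime (suc r) r<p p∣ with coprime-Bézout (prime⇒coprime pr r<p)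
  ... | Bézout.+- x y e = - + y ,
      subst (+ p ∣_) (lemma b (+ suc r) (+ y) (+ x * + p) (1+-cancel y (suc r) x p (cong +_ e)))
        (∣m∣n⇒∣m+n (∣m⇒∣m*n (- + y) p∣) (∣m⇒∣-m (∣n⇒∣m*n (+ x) ∣-refl)))
    where
    expand : ∀ b r y → (b - r) * - y + - (1ℤ + y * r) ≡ b * - y - 1ℤ
    expand = solve-∀
    lemma : ∀ b r y z → 1ℤ + y * r ≡ z → (b - r) * - y + - z ≡ b * - y - 1ℤ
    lemma b r y _ refl = expand b r y
  ... | Bézout.-+ x y e = + y ,
      subst (+ p ∣_) (lemma b (+ suc r) (+ y) (+ x * + p) (1+-cancel x p y (suc r) (cong +_ e)))
        (∣m∣n⇒∣m+n (∣m⇒∣m*n (+ y) p∣) (∣n⇒∣m*n (+ x) ∣-refl))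
    where
    expand : ∀ b r y z → (b - r) * y + z ≡ b * y - 1ℤ + (1ℤ + z - y * r)
    expand = solve-∀
    lemma : ∀ b r y z → 1ℤ + z ≡ y * r → (b - r) * y + z ≡ b * y - 1ℤ
    lemma b r y z e = trans (expand b r y z)
      (trans (cong (λ w → b * y - 1ℤ + (w - y * r)) e)
        (trans (cong (λ w → b * y - 1ℤ + w) (ℤ.+-inverseʳ (y * r))) (ℤ.+-identityʳ _)))
... | u , divides s bu-1≡ | v , divides t bv-1≡ = u + v - b * u * v ,
    divides (- (s * t)) (trans (lemma b u v)
      (trans (cong₂ (λ x y → - (x * y)) bu-1≡ bv-1≡) (regroup s t (+ p) ((+ p) ^ k))))
  where
  lemma : ∀ b u v → b * (u + v - b * u * v) - 1ℤ ≡ - ((b * u - 1ℤ) * (b * v - 1ℤ))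
  lemma = solve-∀
  regroup : ∀ s t p q → - (s * q * (t * p)) ≡ - (s * t) * (p * q)
  regroup = solve-∀

^-∣ : ∀ x {m n} → m ≤ n → x ^ m ∣ x ^ n
^-∣ x {m} {n} m≤n = divides (x ^ (n ℕ.∸ m)) (begin
  x ^ n                   ≡⟨ cong (x ^_) (sym (ℕ.m∸n+n≡m m≤n)) ⟩
  x ^ (n ℕ.∸ m ℕ.+ m)     ≡⟨ ℤ.^-distribˡ-+-* x (n ℕ.∸ m) m ⟩
  x ^ (n ℕ.∸ m) * x ^ m   ∎)
  where open ≡-Reasoning

pos-^ : ∀ p n → + (p ℕ.^ n) ≡ (+ p) ^ n
pos-^ p zero    = refl
pos-^ p (suc n) = trans (ℤ.pos-* p (p ℕ.^ n)) (cong (+ p *_) (pos-^ p n))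

-- The p-adic valuation of `a` cut off at `m`; in `low`, `t` is m - 1 - j.
data Exponent (p : ℤ) (m : ℕ) (a : ℤ) : Set where
  high : ∀ b → a ≡ b * p ^ m → Exponent p m a
  low  : ∀ j t b → m ≡ suc (j ℕ.+ t) → a ≡ b * p ^ j → ¬ p ∣ b → Exponent p m a

*-rotate : ∀ b p q → b * q * p ≡ b * (p * q)
*-rotate = solve-∀

exponent : ∀ p m a → Exponent p m a
exponent p zero    a = high a (sym (ℤ.*-identityʳ a))
exponent p (suc m) a with p ∣? a
... | no p∤a = low 0 m a refl (sym (ℤ.*-identityʳ a)) p∤a
... | yes (divides q refl) with exponent p m q
...   | high b refl               = high b (*-rotate b p (p ^ m))
...   | low j t b refl refl p∤b = low (suc j) t b refl (*-rotate b p (p ^ j)) p∤b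

-- A first move c at the constant coefficient after which Wanda keeps a root
-- modulo q: she either sets a₁ = 1 or answers Nora's choice of a₁ by a₂.
record Plan (d : ℕ) (q : ℤ) : Set where
  field
    constant  : ℤ
    nonzero   : ¬ q ∣ constant
    linear    : ∀ (f : Vector ℤ (4 ℕ.+ d)) → f zero ≡ constant → f (suc zero) ≡ 1ℤ →
                ∃[ w ] q ∣ horner f w
    quadratic : ∀ a → ∃[ b ] (∀ (f : Vector ℤ (4 ℕ.+ d)) →
                f zero ≡ constant → f (suc zero) ≡ a → f (suc (suc zero)) ≡ b →
                ∃[ w ] q ∣ horner f w)

-- If a₁ has exponent j < m, the root of the linear part has exponent 2m - j,
-- which makes the higher terms vanish.
linearRoot : ∀ {p} → Prime p → ∀ {k} m j t b → m ≡ suc (j ℕ.+ t) → k ≤ 2 ℕ.+ (m ℕ.+ m) →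
  ¬ + p ∣ b → ∀ {n} (f : Vector ℤ (2 ℕ.+ n)) → f zero ≡ (+ p) ^ (m ℕ.+ m) →
  f (suc zero) ≡ b * (+ p) ^ j → ∃[ w ] (+ p) ^ k ∣ horner f w
linearRoot {p} pr {k} m j t b m≡ k≤ p∤b f f₀ f₁ with primePow-inverse pr k b p∤b
... | u , q∣bu-1 = w , subst ((+ p) ^ k ∣_) (sym (begin
    horner f w
      ≡⟨ cong₂ (λ x y → x + w * (y + w * h)) f₀ f₁ ⟩
    (+ p) ^ (m ℕ.+ m) + w * (b * (+ p) ^ j + w * h)
      ≡⟨ cong (_+ w * (b * (+ p) ^ j + w * h)) split ⟩
    (+ p) ^ j * v + w * (b * (+ p) ^ j + w * h)
      ≡⟨ identity ((+ p) ^ j) v b u h ⟩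
    - ((+ p) ^ j * v) * (b * u - 1ℤ) + u * u * h * (v * v) ∎))
    (∣m∣n⇒∣m+n (∣n⇒∣m*n (- ((+ p) ^ j * v)) q∣bu-1) (∣n⇒∣m*n (u * u * h) q∣v²))
  where
  open ≡-Reasoning
  v w h : ℤ
  -- As m = 1 + j + t, this exponent is 2m - j and at least m + 1, so `v * v` vanishes modulo pᵏ.
  v = (+ p) ^ (m ℕ.+ suc t)
  w = - (v * u)
  h = horner (λ i → f (suc (suc i))) w
  identity : ∀ P v b u h → P * v + - (v * u) * (b * P + - (v * u) * h) ≡
                           - (P * v) * (b * u - 1ℤ) + u * u * h * (v * v)
  identity = solve-∀
  exponents : ∀ m j t → m ≡ suc (j ℕ.+ t) → m ℕ.+ m ≡ j ℕ.+ (m ℕ.+ suc t)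
  exponents m j t refl = lemma j t
    where
    lemma : ∀ j t → suc (j ℕ.+ t) ℕ.+ suc (j ℕ.+ t) ≡ j ℕ.+ (suc (j ℕ.+ t) ℕ.+ suc t)
    lemma = ℕ.solve-∀
  split : (+ p) ^ (m ℕ.+ m) ≡ (+ p) ^ j * v
  split = trans (cong ((+ p) ^_) (exponents m j t m≡)) (ℤ.^-distribˡ-+-* (+ p) j (m ℕ.+ suc t))
  q∣v² : (+ p) ^ k ∣ v * v
  q∣v² = subst ((+ p) ^ k ∣_) (ℤ.^-distribˡ-+-* (+ p) (m ℕ.+ suc t) (m ℕ.+ suc t))
    (^-∣ (+ p) (ℕ.≤-trans k≤ (ℕ.≤-trans (ℕ.m≤m+n _ (t ℕ.+ t)) (ℕ.≤-reflexive (lemma m t)))))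
    where
    lemma : ∀ m t → 2 ℕ.+ (m ℕ.+ m) ℕ.+ (t ℕ.+ t) ≡ (m ℕ.+ suc t) ℕ.+ (m ℕ.+ suc t)
    lemma = ℕ.solve-∀

-- The one part of a plan that depends on p and k beyond `linearRoot`: the answer when pᵐ divides
-- a₁.
HighReply : ℕ → ℕ → ℕ → ℕ → Set
HighReply d p m k = ∀ a → ∃[ b ] (∀ (f : Vector ℤ (4 ℕ.+ d)) →
  f zero ≡ (+ p) ^ (m ℕ.+ m) → f (suc zero) ≡ a * (+ p) ^ m → f (suc (suc zero)) ≡ b →
  ∃[ w ] (+ p) ^ k ∣ horner f w)

plan : ∀ {d p k} → Prime p → ∀ m → 0 < m → m ℕ.+ m < k → k ≤ 2 ℕ.+ (m ℕ.+ m) →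
       HighReply d p m k → Plan d ((+ p) ^ k)
plan {d} {p} {k} pr m@(suc t) _ 2m<k k≤ reply = record
  { constant  = (+ p) ^ (m ℕ.+ m)
  ; nonzero   = subst (λ x → ¬ (+ p) ^ k ∣ x) (pos-^ p (m ℕ.+ m))
      (subst (λ x → ¬ x ∣ + (p ℕ.^ (m ℕ.+ m))) (pos-^ p k)
        (∤-small (p ℕ.^ (m ℕ.+ m)) {{ℕ.m^n≢0 p (m ℕ.+ m) {{prime⇒nonZero pr}}}}
          (ℕ.^-monoʳ-< p (ℕ.nonTrivial⇒n>1 p {{prime⇒nonTrivial pr}}) 2m<k)))
  -- The coefficient 1 has exponent 0, which lies below m because m is positive.
  ; linear    = λ f f₀ f₁ → linearRoot pr m 0 t 1ℤ refl k≤ (∤1 pr) f f₀ f₁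
  ; quadratic = λ a → respondTo a (exponent (+ p) m a)
  }
  where
  respondTo : ∀ a → Exponent (+ p) m a → ∃[ b ] (∀ (f : Vector ℤ (4 ℕ.+ d)) →
    f zero ≡ (+ p) ^ (m ℕ.+ m) → f (suc zero) ≡ a → f (suc (suc zero)) ≡ b →
    ∃[ w ] (+ p) ^ k ∣ horner f w)
  respondTo a (high b refl) = reply b
  respondTo a (low j t b m≡ refl p∤b) =
    -- The root exists for every a₂, so `0ℤ` is an arbitrary value.
    0ℤ , λ f f₀ f₁ _ → linearRoot pr m j t b m≡ k≤ p∤b f f₀ f₁

-- With a₂ = - (1 + b), the terms below the cubic one cancel at x = pᵐ.
highReply-cubic : ∀ {d p k} m → k ≤ m ℕ.+ (m ℕ.+ m) → HighReply d p m k
highReply-cubic {d} {p} {k} m k≤3m b = - (1ℤ + b) , λ f f₀ f₁ f₂ →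
  let h = horner (λ i → f (suc (suc (suc i)))) r in
  r , subst ((+ p) ^ k ∣_) (sym (begin
    horner f r
      ≡⟨ cong₂ (λ x y → x + r * (y + r * (f (suc (suc zero)) + r * h))) f₀ f₁ ⟩
    (+ p) ^ (m ℕ.+ m) + r * (b * r + r * (f (suc (suc zero)) + r * h))
      ≡⟨ cong₂ (λ x y → x + r * (b * r + r * (y + r * h))) (ℤ.^-distribˡ-+-* (+ p) m m) f₂ ⟩
    r * r + r * (b * r + r * (- (1ℤ + b) + r * h))
      ≡⟨ identity r b h ⟩
    h * (r * (r * r)) ∎)) (∣n⇒∣m*n h q∣r³)
  where
  open ≡-Reasoning
  r : ℤ
  r = (+ p) ^ m
  identity : ∀ r b h → r * r + r * (b * r + r * (- (1ℤ + b) + r * h)) ≡ h * (r * (r * r))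
  identity = solve-∀
  q∣r³ : (+ p) ^ k ∣ r * (r * r)
  q∣r³ = subst ((+ p) ^ k ∣_)
    (trans (ℤ.^-distribˡ-+-* (+ p) m (m ℕ.+ m)) (cong (r *_) (ℤ.^-distribˡ-+-* (+ p) m m)))
    (^-∣ (+ p) k≤3m)

-- With a₂ = - (1 + b) the polynomial has the simple root x = p modulo p³,
-- because 2 + b is a unit; it lifts to x = p (1 + p t).
oddQuartic-lift : ∀ p b c u → p ∣ (+ 2 + b) * u - 1ℤ →
  ∃[ w ] (∀ h → p ^ 4 ∣
    p * p + w * (b * p + w * (- (1ℤ + b) + w * (c + w * h))))
oddQuartic-lift p b c u (divides s e) = p * z , λ h →
  divides (- ((1ℤ + b) * (t * t)) + y + z * z * z * z * h - c * s) (begin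
    p * p + p * z * (b * p + p * z * (- (1ℤ + b) + p * z * (c + p * z * h)))
      ≡⟨ collect p b c z h ⟩
    p * p * ((1ℤ + b * z - (1ℤ + b) * (z * z)) + p * (c * (z * z * z)) + p * p * (z * z * z * z * h))
      ≡⟨ cong₂ (λ v w → p * p * (v + p * w + p * p * (z * z * z * z * h)))
           (square b p t) (cube c p t) ⟩
    p * p * ((- (p * t * (+ 2 + b)) - p * p * ((1ℤ + b) * (t * t)))
      + p * (c + p * y) + p * p * (z * z * z * z * h))
      ≡⟨ separate p b c u y (z * z * z * z * h) ⟩
    (- ((1ℤ + b) * (t * t)) + y + z * z * z * z * h) * p ^ 4 - c * ((+ 2 + b) * u - 1ℤ) * p ^ 3
      ≡⟨ cong (λ x → (- ((1ℤ + b) * (t * t)) + y + z * z * z * z * h) * p ^ 4 - c * x * p ^ 3) e ⟩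
    (- ((1ℤ + b) * (t * t)) + y + z * z * z * z * h) * p ^ 4 - c * (s * p) * p ^ 3
      ≡⟨ regroup (- ((1ℤ + b) * (t * t)) + y + z * z * z * z * h) c s p ⟩
    (- ((1ℤ + b) * (t * t)) + y + z * z * z * z * h - c * s) * p ^ 4 ∎)
  where
  open ≡-Reasoning
  t z y : ℤ
  -- At p (1 + p t) the p² terms cancel and p³ has coefficient c - (2 + b) t modulo p. As `u`
  -- inverts 2 + b modulo p, this `t` makes it vanish there.
  t = c * u
  z = 1ℤ + p * t
  y = c * t * (+ 3 + + 3 * (p * t) + p * t * (p * t))
  collect : ∀ p b c z h →
    p * p + p * z * (b * p + p * z * (- (1ℤ + b) + p * z * (c + p * z * h))) ≡
    p * p * ((1ℤ + b * z - (1ℤ + b) * (z * z)) + p * (c * (z * z * z)) + p * p * (z * z * z * z * h))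
  collect = solve-∀
  square : ∀ b p t → 1ℤ + b * (1ℤ + p * t) - (1ℤ + b) * ((1ℤ + p * t) * (1ℤ + p * t)) ≡
    - (p * t * (+ 2 + b)) - p * p * ((1ℤ + b) * (t * t))
  square = solve-∀
  cube : ∀ c p t → c * ((1ℤ + p * t) * (1ℤ + p * t) * (1ℤ + p * t)) ≡
    c + p * (c * t * (+ 3 + + 3 * (p * t) + p * t * (p * t)))
  cube = solve-∀
  separate : ∀ p b c u y w →
    p * p * ((- (p * (c * u) * (+ 2 + b)) - p * p * ((1ℤ + b) * (c * u * (c * u))))
      + p * (c + p * y) + p * p * w) ≡
    (- ((1ℤ + b) * (c * u * (c * u))) + y + w) * (p * (p * (p * (p * 1ℤ))))
      - c * ((+ 2 + b) * u - 1ℤ) * (p * (p * (p * 1ℤ)))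
  separate = solve-∀
  regroup : ∀ r c s p → r * (p * (p * (p * (p * 1ℤ)))) - c * (s * p) * (p * (p * (p * 1ℤ)))
                        ≡ (r - c * s) * (p * (p * (p * (p * 1ℤ))))
  regroup = solve-∀

horner-suc : ∀ {n} (f : Vector ℤ (suc n)) x →
             horner f x ≡ f zero + x * horner (λ i → f (suc i)) x
horner-suc f x = refl

horner-expand : ∀ {n} (f : Vector ℤ (4 ℕ.+ n)) x → horner f x ≡
  f zero + x * (f (suc zero) + x * (f (suc (suc zero)) + x * (f (suc (suc (suc zero)))
    + x * horner (λ i → f (suc (suc (suc (suc i))))) x)))
horner-expand f x = trans (horner-suc f x) (cong (λ h → f zero + x * h)
  (trans (horner-suc (λ i → f (suc i)) x) (cong (λ h → f (suc zero) + x * h)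
    (trans (horner-suc (λ i → f (suc (suc i))) x) (cong (λ h → f (suc (suc zero)) + x * h)
      (horner-suc (λ i → f (suc (suc (suc i)))) x))))))

oddQuartic-root : ∀ {d} p b u (f : Vector ℤ (4 ℕ.+ d)) → p ∣ (+ 2 + b) * u - 1ℤ →
  f zero ≡ p ^ 2 → f (suc zero) ≡ b * p ^ 1 → f (suc (suc zero)) ≡ - (1ℤ + b) →
  ∃[ w ] p ^ 4 ∣ horner f w
oddQuartic-root {d} p b u f p∣ f₀ f₁ f₂ =
    fromLift (oddQuartic-lift p b (f (suc (suc (suc zero)))) u p∣)
  where
  lemma : ∀ p b w c h →
    p * (p * 1ℤ) + w * (b * (p * 1ℤ) + w * (- (1ℤ + b) + w * (c + w * h))) ≡
    p * p + w * (b * p + w * (- (1ℤ + b) + w * (c + w * h)))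
  lemma = solve-∀
  rewriteAt : ∀ w a₀ a₁ a₂ c h → a₀ ≡ p ^ 2 → a₁ ≡ b * p ^ 1 → a₂ ≡ - (1ℤ + b) →
    a₀ + w * (a₁ + w * (a₂ + w * (c + w * h))) ≡
    p * p + w * (b * p + w * (- (1ℤ + b) + w * (c + w * h)))
  rewriteAt w _ _ _ c h refl refl refl = lemma p b w c h
  fromLift : ∃[ w ] (∀ h → p ^ 4 ∣
      p * p + w * (b * p + w * (- (1ℤ + b) + w * (f (suc (suc (suc zero))) + w * h)))) →
    ∃[ w ] p ^ 4 ∣ horner f w
  fromLift (w , lift) = w , subst (p ^ 4 ∣_)
    (sym (trans (horner-expand f w) (rewriteAt w (f zero) (f (suc zero)) (f (suc (suc zero))) (f (suc (suc (suc zero))))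
      (horner (λ i → f (suc (suc (suc (suc i))))) w) f₀ f₁ f₂)))
    (lift (horner (λ i → f (suc (suc (suc (suc i))))) w))

-- Substituting -x for x flips the signs of `b` and a₃, so `oddQuartic-lift` applies again.
oddQuartic-root⁻ : ∀ {d} p b u (f : Vector ℤ (4 ℕ.+ d)) → p ∣ (+ 2 - b) * u - 1ℤ →
  f zero ≡ p ^ 2 → f (suc zero) ≡ b * p ^ 1 → f (suc (suc zero)) ≡ - (1ℤ - b) →
  ∃[ w ] p ^ 4 ∣ horner f w
oddQuartic-root⁻ {d} p b u f p∣ f₀ f₁ f₂ =
    fromLift (oddQuartic-lift p (- b) (- f (suc (suc (suc zero)))) u p∣)
  where
  lemma : ∀ p b w c h →
    p * (p * 1ℤ) + - w * (b * (p * 1ℤ) + - w * (- (1ℤ - b) + - w * (c + - w * h))) ≡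
    p * p + w * (- b * p + w * (- (1ℤ - b) + w * (- c + w * h)))
  lemma = solve-∀
  rewriteAt : ∀ w a₀ a₁ a₂ c h → a₀ ≡ p ^ 2 → a₁ ≡ b * p ^ 1 → a₂ ≡ - (1ℤ - b) →
    a₀ + - w * (a₁ + - w * (a₂ + - w * (c + - w * h))) ≡
    p * p + w * (- b * p + w * (- (1ℤ - b) + w * (- c + w * h)))
  rewriteAt w _ _ _ c h refl refl refl = lemma p b w c h
  fromLift : ∃[ w ] (∀ h → p ^ 4 ∣
      p * p + w * (- b * p + w * (- (1ℤ - b) + w * (- f (suc (suc (suc zero))) + w * h)))) →
    ∃[ w ] p ^ 4 ∣ horner f w
  fromLift (w , lift) = - w , subst (p ^ 4 ∣_)
    (sym (trans (horner-expand f (- w)) (rewriteAt w (f zero) (f (suc zero)) (f (suc (suc zero))) (f (suc (suc (suc zero))))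
      (horner (λ i → f (suc (suc (suc (suc i))))) (- w)) f₀ f₁ f₂)))
    (lift (horner (λ i → f (suc (suc (suc (suc i))))) (- w)))

prime∣2 : ∀ {p} → Prime p → + p ∣ + 2 → p ≡ 2
prime∣2 pr p∣2 with prime⇒irreducible prime[2] (∣⇒∣ᵤ p∣2)
... | inj₁ refl = contradiction pr ¬prime[1]
... | inj₂ p≡2  = p≡2

-- By her choice of a₂ Wanda makes p or - p a root of the quadratic part; the
-- derivative there is - (2 + b) p or (2 - b) p, and (2 + b) + (2 - b) = 4.
highReply-oddQuartic : ∀ {d p} → Prime p → p ≢ 2 → HighReply d p 1 4
highReply-oddQuartic {d} {p} pr p≢2 b with ∤-+ {+ p} (+ 2 + b) (+ 2 - b) p∤4
  where
  sum : ∀ b → + 2 + b + (+ 2 - b) ≡ + 4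
  sum = solve-∀
  p∤4 : ¬ + p ∣ + 2 + b + (+ 2 - b)
  p∤4 p∣4 = [ p≢2 ∘ prime∣2 pr , p≢2 ∘ prime∣2 pr ]′
              (euclid pr (+ 2) (+ 2) (subst (+ p ∣_) (sum b) p∣4))
... | inj₁ p∤ = case primePow-inverse pr 1 (+ 2 + b) p∤ of λ (u , p∣) →
    - (1ℤ + b) , λ f → oddQuartic-root (+ p) b u f
      (subst (_∣ (+ 2 + b) * u - 1ℤ) (ℤ.*-identityʳ (+ p)) p∣)
... | inj₂ p∤ = case primePow-inverse pr 1 (+ 2 - b) p∤ of λ (u , p∣) →
    - (1ℤ - b) , λ f → oddQuartic-root⁻ (+ p) b u f
      (subst (_∣ (+ 2 - b) * u - 1ℤ) (ℤ.*-identityʳ (+ p)) p∣)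

-- The trailing `x * 0ℤ` is what `horner-expand` leaves of a vector of length four.
cubic : (a₀ a₁ a₂ a₃ x : ℤ) → ℤ
cubic a₀ a₁ a₂ a₃ x = a₀ + x * (a₁ + x * (a₂ + x * (a₃ + x * 0ℤ)))

-- The derivative is odd at odd x, so this is a Hensel step.
oddRoot-lift : ∀ a₀ b a₂ s K z →
  + 2 * K ∣ cubic a₀ (b * + 2) a₂ (1ℤ + s * + 2) (1ℤ + z * + 2) →
  ∃[ z′ ] + 2 * (+ 2 * K) ∣ cubic a₀ (b * + 2) a₂ (1ℤ + s * + 2) (1ℤ + z′ * + 2)
oddRoot-lift a₀ b a₂ s K z (divides q e) with parity q
... | even r refl = z , divides r (trans e (regroup r K))
  where
  regroup : ∀ r K → r * + 2 * (+ 2 * K) ≡ r * (+ 2 * (+ 2 * K))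
  regroup = solve-∀
-- Moving x by 2K changes the value by 2K times the derivative, up to a multiple of 4K. The
-- derivative is odd, so the odd quotient becomes even.
... | odd r refl = z + K , divides (1ℤ + r + (half + K * rest)) (begin
    cubic a₀ (b * + 2) a₂ a₃ (1ℤ + (z + K) * + 2)
      ≡⟨ cong (cubic a₀ (b * + 2) a₂ a₃) (shift z K) ⟩
    cubic a₀ (b * + 2) a₂ a₃ (x + + 2 * K)
      ≡⟨ taylor a₀ (b * + 2) a₂ a₃ x K ⟩
    cubic a₀ (b * + 2) a₂ a₃ x + (b * + 2 + + 2 * a₂ * x + + 3 * a₃ * (x * x) + + 2 * K * rest) * (+ 2 * K)
      ≡⟨ cong₂ (λ u v → u + (v + + 2 * K * rest) * (+ 2 * K)) e (derivative b a₂ s x z) ⟩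
    (1ℤ + r * + 2) * (+ 2 * K) + (1ℤ + half * + 2 + + 2 * K * rest) * (+ 2 * K)
      ≡⟨ regroup r K half rest ⟩
    (1ℤ + r + (half + K * rest)) * (+ 2 * (+ 2 * K)) ∎)
  where
  open ≡-Reasoning
  a₃ x half rest : ℤ
  a₃ = 1ℤ + s * + 2
  x  = 1ℤ + z * + 2
  half = b + a₂ * x + (1ℤ + + 3 * s) + + 6 * (1ℤ + s * + 2) * (z + z * z)
  rest = a₂ + + 3 * a₃ * x + + 2 * a₃ * K
  shift : ∀ z K → 1ℤ + (z + K) * + 2 ≡ (1ℤ + z * + 2) + + 2 * K
  shift = solve-∀
  taylor : ∀ a₀ a₁ a₂ a₃ x K →
    a₀ + (x + + 2 * K) * (a₁ + (x + + 2 * K) * (a₂ + (x + + 2 * K) * (a₃ + (x + + 2 * K) * 0ℤ))) ≡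
    a₀ + x * (a₁ + x * (a₂ + x * (a₃ + x * 0ℤ))) +
      (a₁ + + 2 * a₂ * x + + 3 * a₃ * (x * x) + + 2 * K * (a₂ + + 3 * a₃ * x + + 2 * a₃ * K)) * (+ 2 * K)
  taylor = solve-∀
  derivative : ∀ b a₂ s y z →
    b * + 2 + + 2 * a₂ * y + + 3 * (1ℤ + s * + 2) * ((1ℤ + z * + 2) * (1ℤ + z * + 2)) ≡
    1ℤ + (b + a₂ * y + (1ℤ + + 3 * s) + + 6 * (1ℤ + s * + 2) * (z + z * z)) * + 2
  derivative = solve-∀
  regroup : ∀ r K h R → (1ℤ + r * + 2) * (+ 2 * K) + (1ℤ + h * + 2 + + 2 * K * R) * (+ 2 * K) ≡
                        (1ℤ + r + (h + K * R)) * (+ 2 * (+ 2 * K))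
  regroup = solve-∀

cubicRoot : ∀ {k a₀ a₁ a₂} (f : Vector ℤ 4) → f zero ≡ a₀ → f (suc zero) ≡ a₁ →
  f (suc (suc zero)) ≡ a₂ → ∃[ w ] k ∣ cubic a₀ a₁ a₂ (f (suc (suc (suc zero)))) w →
  ∃[ w ] k ∣ horner f w
cubicRoot {k} f refl refl refl (w , p) = w , subst (k ∣_) (sym (horner-expand f w)) p

-- At x = -2v with v odd the value is 4 (1 - v (1 + 2 (z + c))) modulo 16. An odd number is its own
-- inverse modulo 4, so v = 1 + 2 (z + c).
sixteen-odd : ∀ z c → ∃[ w ] + 16 ∣ cubic (+ 4) ((1ℤ + z * + 2) * + 2) 0ℤ c w
sixteen-odd z c = - (+ 2 * (1ℤ + (z + c) * + 2)) ,
  divides (- ((z + c) * (1ℤ + (z + c))) * (1ℤ + + 2 * c * (1ℤ + (z + c) * + 2))) (identity z c)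
  where
  identity : ∀ z c → + 4 + - (+ 2 * (1ℤ + (z + c) * + 2)) * ((1ℤ + z * + 2) * + 2 +
    - (+ 2 * (1ℤ + (z + c) * + 2)) * (0ℤ + - (+ 2 * (1ℤ + (z + c) * + 2)) *
      (c + - (+ 2 * (1ℤ + (z + c) * + 2)) * 0ℤ))) ≡
    - ((z + c) * (1ℤ + (z + c))) * (1ℤ + + 2 * c * (1ℤ + (z + c) * + 2)) * + 16
  identity = solve-∀

-- This a₂ serves both parities of a₃ = c: for even c, 2 is a root modulo 16; for odd c, 1 is a root
-- modulo 2 and three lifts reach 16.
sixteen-even : ∀ z {c} → Parity c →
               ∃[ w ] + 16 ∣ cubic (+ 4) (z * + 2 * + 2) (- (1ℤ + z * + 2)) c w
sixteen-even z (even s refl) = + 2 , divides s (at2 z s)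
  where
  at2 : ∀ z s → + 4 + + 2 * (z * + 2 * + 2 + + 2 * (- (1ℤ + z * + 2) + + 2 * (s * + 2 + + 2 * 0ℤ))) ≡ s * + 16
  at2 = solve-∀
sixteen-even z (odd s refl) =
  let z₁ , p₁ = lift 1ℤ 0ℤ (divides (+ 2 + z + s) (at1 z s))
      z₂ , p₂ = lift (+ 2) z₁ p₁
      z₃ , p₃ = lift (+ 4) z₂ p₂
  in 1ℤ + z₃ * + 2 , p₃
  where
  lift = oddRoot-lift (+ 4) (z * + 2) (- (1ℤ + z * + 2)) s
  at1 : ∀ z s → + 4 + 1ℤ * (z * + 2 * + 2 + 1ℤ * (- (1ℤ + z * + 2) + 1ℤ * (1ℤ + s * + 2 + 1ℤ * 0ℤ))) ≡
                (+ 2 + z + s) * + 2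
  at1 = solve-∀

-- In degree 3 only a₃ is left to Nora. Wanda's a₂ depends on the parity of `b`, while the root may
-- depend on a₃.
highReply-sixteen : HighReply 0 2 1 4
highReply-sixteen b = reply (parity b)
  where
  reply : ∀ {b} → Parity b → ∃[ a₂ ] (∀ (f : Vector ℤ 4) → f zero ≡ + 4 →
    f (suc zero) ≡ b * + 2 → f (suc (suc zero)) ≡ a₂ → ∃[ w ] + 16 ∣ horner f w)
  reply (odd z refl)  = 0ℤ , λ f f₀ f₁ f₂ →
    cubicRoot f f₀ f₁ f₂ (sixteen-odd z (f (suc (suc (suc zero)))))
  reply (even z refl) = - (1ℤ + z * + 2) , λ f f₀ f₁ f₂ →
    cubicRoot f f₀ f₁ f₂ (sixteen-even z (parity (f (suc (suc (suc zero))))))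

-- Wanda moves first but not last

∣-cancel-inverse : ∀ {q} m u x → q ∣ m * u - 1ℤ → q ∣ x * m → q ∣ x
∣-cancel-inverse {q} m u x q∣mu-1 q∣xm = subst (q ∣_) (lemma m u x)
  (∣m∣n⇒∣m-n (∣m⇒∣m*n u q∣xm) (∣n⇒∣m*n x q∣mu-1))
  where
  lemma : ∀ m u x → x * m * u - x * (m * u - 1ℤ) ≡ x
  lemma = solve-∀

-- With e ≡ 1 modulo pᵏ and e ≡ 0 modulo M, a root w modulo pᵏ gives the root
-- e w modulo N, since the constant coefficient e c vanishes modulo M.
plan⇒wins : ∀ {N p k d} M → 1 < N → Prime p → N ≡ p ℕ.^ k ℕ.* M → ¬ p ℕ.∣ M →
            Plan d ((+ p) ^ k) → Game.HasWinningStrategy (ℤ/ N ℤ) (3 ℕ.+ d) wanda wanda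
plan⇒wins {N} {p} {k} {d} M 1<N pr N≡ p∤M localPlan =
    globalise (primePow-inverse pr k (+ M) (p∤M ∘ ∣⇒∣ᵤ))
  where
  open Plan localPlan
  open Game (ℤ/ N ℤ) (3 ℕ.+ d)
  open Play (ℤ/ N ℤ) (3 ℕ.+ d) (1≉0 1<N)
  q : ℤ
  q = (+ p) ^ k

  N≡qM : + N ≡ q * + M
  N≡qM = trans (cong +_ N≡) (trans (ℤ.pos-* (p ℕ.^ k) M) (cong (_* + M) (pos-^ p k)))

  globalise : ∃[ u ] q ∣ + M * u - 1ℤ → HasWinningStrategy wanda wanda
  globalise (u , q∣e-1) = choose zero (e * constant)
      (refl , λ _ ≈0 → nonzero (∣-resp-mod {x = e * constant} {constant} q∣ec-c
        (∣-trans q∣N (≈0⇒∣ {a = e * constant} ≈0))))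
      (respond (suc zero , refl) λ where
        zero          _ (() , _)
        (suc zero)    a _ → case quadratic a of λ (b , wins) →
          choose (suc (suc zero)) b (refl , λ { (inj₁ ()) ; (inj₂ ()) })
            (sure _ _ _ refl λ f ext → lifted f (ext zero refl)
              (wins (local f) refl (ext (suc zero) refl) (ext (suc (suc zero)) refl)))
        (suc (suc j)) a _ →
          choose (suc zero) 1ℤ (refl , λ { (inj₁ ()) ; (inj₂ ()) })
            (sure _ _ _ refl λ f ext → lifted f (ext zero refl)
              (linear (local f) refl (ext (suc zero) refl))))
    where
    e : ℤ
    e = + M * u

    q∣N : q ∣ + N
    q∣N = subst (q ∣_) (sym N≡qM) (∣m⇒∣m*n (+ M) ∣-refl)

    e-1-factor : ∀ e c → (e - 1ℤ) * c ≡ e * c - c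
    e-1-factor = solve-∀

    q∣ec-c : q ∣ e * constant - constant
    q∣ec-c = subst (q ∣_) (e-1-factor e constant) (∣m⇒∣m*n constant q∣e-1)

    -- The plan speaks of the exact constant coefficient `constant`, which agrees with the one
    -- played only modulo `q`; hence the replacement.
    local : Polynomial → Polynomial
    local f = constant Vector.∷ (λ i → f (suc i))

    -- Coprimality of `q` and `M` enters through the inverse `u` of `M` modulo `q`.
    glue : ∀ x → q ∣ x → + M ∣ x → + N ∣ x
    glue _ q∣x (divides g refl) = subst (_∣ g * + M) (sym N≡qM)
      (*-monoˡ-∣ (+ M) (∣-cancel-inverse (+ M) u g q∣e-1 q∣x))

    lifted : ∀ f → f zero ≡ e * constant → ∃[ w ] q ∣ horner (local f) w → HasRoot f
    lifted f f₀ (w , q∣w) = root f (e * w) (subst (+ N ∣_) (sym expand)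
        (glue (e * constant + e * w * h) byPrime (divides (u * constant + u * w * h)
          (factorM (+ M) u constant w h))))
      where
      h : ℤ
      h = horner (λ i → f (suc i)) (e * w)
      expand : horner f (e * w) ≡ e * constant + e * w * h
      expand = cong (_+ e * w * h) f₀
      factorM : ∀ M u c w h → M * u * c + M * u * w * h ≡ (u * c + u * w * h) * M
      factorM = solve-∀
      distance : ∀ e w → - ((e - 1ℤ) * w) ≡ w - e * w
      distance = solve-∀
      swap : ∀ e c y → (c + y) - (- (e * c - c)) ≡ e * c + y
      swap = solve-∀
      byPrime : q ∣ e * constant + e * w * h
      byPrime = subst (q ∣_) (swap e constant (e * w * h))
        (∣m∣n⇒∣m-n
          (∣-resp-mod {x = horner (local f) w} {constant + e * w * h} (horner-cong-mod (local f) {w} {e * w}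
            (subst (q ∣_) (distance e w) (∣m⇒∣-m (∣m⇒∣m*n w q∣e-1)))) q∣w)
          (∣m⇒∣-m q∣ec-c))

halve : ∀ n → (∃[ k ] n ≡ k ℕ.* 2) ⊎ (∃[ k ] n ≡ suc (k ℕ.* 2))
halve zero = inj₁ (0 , refl)
halve (suc n) with halve n
... | inj₁ (k , refl) = inj₂ (k , refl)
... | inj₂ (k , refl) = inj₁ (suc k , refl)

-- The exponent k is handled by m with 2m < k ≤ 3m, which exists unless k = 4.
planFor : ∀ {d p} → Prime p → ∀ k → (k ≡ 1 → p ≡ 2 → d ≡ 0) → Plan d ((+ p) ^ (3 ℕ.+ k))
planFor {p = p} pr zero _ = plan pr 1 (ℕ.m≤m+n 1 0) (ℕ.m≤m+n 3 0) (ℕ.m≤m+n 3 1)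
  (highReply-cubic {p = p} 1 (ℕ.m≤m+n 3 0))
planFor {p = p} pr (suc zero) small with p ℕ.≟ 2
... | no p≢2 = plan pr 1 (ℕ.m≤m+n 1 0) (ℕ.m≤m+n 3 1) (ℕ.m≤m+n 4 0) (highReply-oddQuartic pr p≢2)
... | yes refl with small refl refl
...   | refl = plan pr 1 (ℕ.m≤m+n 1 0) (ℕ.m≤m+n 3 1) (ℕ.m≤m+n 4 0) highReply-sixteen
-- The exponents 5 + 2j and 6 + 2j both take m = 2 + j.
planFor {p = p} pr (suc (suc r)) _ with halve r
... | inj₁ (j , refl) = plan pr (2 ℕ.+ j) (s≤s z≤n)
      (ℕ.≤-reflexive (eq j)) (ℕ.≤-trans (ℕ.m≤m+n _ 1) (ℕ.≤-reflexive (eq′ j)))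
      (highReply-cubic {p = p} (2 ℕ.+ j) (ℕ.≤-trans (ℕ.m≤m+n _ (1 ℕ.+ j)) (ℕ.≤-reflexive (eq″ j))))
  where
  eq : ∀ j → suc ((2 ℕ.+ j) ℕ.+ (2 ℕ.+ j)) ≡ 5 ℕ.+ j ℕ.* 2
  eq = ℕ.solve-∀
  eq′ : ∀ j → 5 ℕ.+ j ℕ.* 2 ℕ.+ 1 ≡ 2 ℕ.+ ((2 ℕ.+ j) ℕ.+ (2 ℕ.+ j))
  eq′ = ℕ.solve-∀
  eq″ : ∀ j → 5 ℕ.+ j ℕ.* 2 ℕ.+ (1 ℕ.+ j) ≡ (2 ℕ.+ j) ℕ.+ ((2 ℕ.+ j) ℕ.+ (2 ℕ.+ j))
  eq″ = ℕ.solve-∀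
... | inj₂ (j , refl) = plan pr (2 ℕ.+ j) (s≤s z≤n)
      (ℕ.≤-trans (ℕ.m≤m+n _ 1) (ℕ.≤-reflexive (eq j))) (ℕ.≤-reflexive (eq′ j))
      (highReply-cubic {p = p} (2 ℕ.+ j) (ℕ.≤-trans (ℕ.m≤m+n _ j) (ℕ.≤-reflexive (eq″ j))))
  where
  eq : ∀ j → suc ((2 ℕ.+ j) ℕ.+ (2 ℕ.+ j)) ℕ.+ 1 ≡ 6 ℕ.+ j ℕ.* 2
  eq = ℕ.solve-∀
  eq′ : ∀ j → 6 ℕ.+ j ℕ.* 2 ≡ 2 ℕ.+ ((2 ℕ.+ j) ℕ.+ (2 ℕ.+ j))
  eq′ = ℕ.solve-∀
  eq″ : ∀ j → 6 ℕ.+ j ℕ.* 2 ℕ.+ j ≡ (2 ℕ.+ j) ℕ.+ ((2 ℕ.+ j) ℕ.+ (2 ℕ.+ j))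
  eq″ = ℕ.solve-∀

-- Case analysis on the factorisation of N

ℕ-rotate : ∀ a b c → a ℕ.* b ℕ.* c ≡ c ℕ.* a ℕ.* b
ℕ-rotate = ℕ.solve-∀

primePowerPart : ∀ {p} → Prime p → ∀ n .{{_ : ℕ.NonZero n}} →
                 ∃[ k ] ∃[ m ] (n ≡ p ℕ.^ k ℕ.* m × ¬ p ℕ.∣ m)
primePowerPart {p} pr n = go n (<-wellFounded n)
  where
  go : ∀ n .{{_ : ℕ.NonZero n}} → Acc _<_ n → ∃[ k ] ∃[ m ] (n ≡ p ℕ.^ k ℕ.* m × ¬ p ℕ.∣ m)
  go n (acc rec) with p ℕ.∣? n
  ... | no p∤n = 0 , n , sym (ℕ.*-identityˡ n) , p∤n
  ... | yes (ℕ.divides zero n≡0) = contradiction n≡0 (ℕ.≢-nonZero⁻¹ n)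
  ... | yes (ℕ.divides r@(suc _) refl) = case go r (rec r<n) of λ (k , m , r≡ , p∤m) →
      suc k , m , trans (cong (ℕ._* p) r≡) (ℕ-rotate (p ℕ.^ k) m p) , p∤m
    where
    r<n : r < r ℕ.* p
    r<n = ℕ.m<m*n r p (ℕ.nonTrivial⇒n>1 p {{prime⇒nonTrivial pr}})

-- A prime whose cube divides `n` is at most `n`, so a finite search decides.
cubeFree? : ∀ n .{{_ : ℕ.NonZero n}} → CubeFree n ⊎ (∃[ p ] (Prime p × p ℕ.^ 3 ℕ.∣ n))
cubeFree? n with Fin.any? {suc n} (λ i → prime? (toℕ i) ×-dec (toℕ i ℕ.^ 3 ℕ.∣? n))
... | yes (i , pr , p³∣n) = inj₂ (toℕ i , pr , p³∣n)
... | no none = inj₁ λ {p} pr p³∣n → none (Fin.fromℕ< (s≤s (p≤n pr p³∣n)) ,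
        subst (λ p → Prime p × p ℕ.^ 3 ℕ.∣ n) (sym (Fin.toℕ-fromℕ< _)) (pr , p³∣n))
  where
  p≤n : ∀ {p} → Prime p → p ℕ.^ 3 ℕ.∣ n → p ≤ n
  p≤n {p} pr p³∣n = ℕ.≤-trans
    (ℕ.m≤m*n p (p ℕ.^ 2) {{ℕ.m^n≢0 p 2 {{prime⇒nonZero pr}}}}) (ℕ.∣⇒≤ p³∣n)

-- The second alternative is the one situation that `planFor` excludes: the exact power 2⁴ in degree
-- above 3.
cubed⇒wins : ∀ {N p} d → 1 < N → Prime p → p ℕ.^ 3 ℕ.∣ N →
  Game.HasWinningStrategy (ℤ/ N ℤ) (3 ℕ.+ d) wanda wanda ⊎
  (p ≡ 2 × d ≢ 0 × ∃[ M ] (N ≡ 16 ℕ.* M × ¬ 2 ℕ.∣ M))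
cubed⇒wins {N} d 1<N pr (ℕ.divides zero N≡0) = contradiction N≡0 (ℕ.m<n⇒n≢0 1<N)
cubed⇒wins {N} {p} d 1<N pr (ℕ.divides r@(suc _) N≡) with primePowerPart pr r
... | k , M , r≡ , p∤M = byExponent k (trans N≡ (trans (cong (ℕ._* p ℕ.^ 3) r≡)
        (trans (ℕ-rotate (p ℕ.^ k) M (p ℕ.^ 3))
          (cong (ℕ._* M) (sym (ℕ.^-distribˡ-+-* p 3 k))))))
  where
  wins : ∀ k → N ≡ p ℕ.^ (3 ℕ.+ k) ℕ.* M → (k ≡ 1 → p ≡ 2 → d ≡ 0) →
         Game.HasWinningStrategy (ℤ/ N ℤ) (3 ℕ.+ d) wanda wanda
  wins k N≡ small = plan⇒wins {k = 3 ℕ.+ k} M 1<N pr N≡ p∤M (planFor pr k small)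
  byExponent : ∀ k → N ≡ p ℕ.^ (3 ℕ.+ k) ℕ.* M →
    Game.HasWinningStrategy (ℤ/ N ℤ) (3 ℕ.+ d) wanda wanda ⊎
    (p ≡ 2 × d ≢ 0 × ∃[ M ] (N ≡ 16 ℕ.* M × ¬ 2 ℕ.∣ M))
  byExponent k N≡ with k ℕ.≟ 1 | p ℕ.≟ 2 | d ℕ.≟ 0
  ... | no k≢1   | _        | _       = inj₁ (wins k N≡ λ k≡1 → contradiction k≡1 k≢1)
  ... | yes _    | no p≢2   | _       = inj₁ (wins k N≡ λ _ p≡2 → contradiction p≡2 p≢2)
  ... | yes _    | yes _    | yes d≡0 = inj₁ (wins k N≡ λ _ _ → d≡0)
  ... | yes refl | yes refl | no d≢0  = inj₂ (refl , d≢0 , M , N≡ , p∤M)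

wandaFirst-odd : ∀ {N} n → 1 < N → ¬ LastPlayerCase (suc (n ℕ.* 2)) N →
  Game.HasWinningStrategy (ℤ/ N ℤ) (suc (n ℕ.* 2)) wanda wanda
wandaFirst-odd {N} zero 1<N _ = choose (suc zero) 1ℤ (refl , const (1≉0 1<N))
    (respond (zero , refl) λ where
      zero       a _ → doneAt (- a) refl (lemma a)
      (suc zero) _ (() , _))
  where
  open Game (ℤ/ N ℤ) 1
  open WandaLast {N} {1} 1<N using (doneAt)
  lemma : ∀ a → 0ℤ ≡ a + - a * (1ℤ + - a * 0ℤ)
  lemma = solve-∀
wandaFirst-odd {N@(suc _)} (suc n) 1<N ¬case =
    [ (λ cubeFree → contradiction (inj₂ (inj₁ (s≤s (s≤s z≤n) , λ {p} → cubeFree {p}))) ¬case)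
    , (λ (p , pr , p³∣N) → [ id , exceptional ]′ (cubed⇒wins (n ℕ.* 2) 1<N pr p³∣N))
    ]′ (cubeFree? N)
  where
  Wins′ : Set
  Wins′ = Game.HasWinningStrategy (ℤ/ N ℤ) (suc (suc n ℕ.* 2)) wanda wanda

  -- Outside case (3), `M` is not cube-free. A prime whose cube divides the odd `M` is not 2, so a
  -- second use of `cubed⇒wins` succeeds.
  exceptional : ∀ {p} → p ≡ 2 × n ℕ.* 2 ≢ 0 × (∃[ M ] (N ≡ 16 ℕ.* M × ¬ 2 ℕ.∣ M)) → Wins′
  exceptional (_ , _ , zero , _ , 2∤0) = contradiction (2 ℕ.∣0) 2∤0
  exceptional (_ , d≢0 , M@(suc _) , N≡16M , 2∤M) =
    [ (λ cubeFree → contradiction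
        (inj₂ (inj₂ (ℕ.m<m+n 3 (ℕ.n≢0⇒n>0 d≢0) , M , N≡16M , (λ {p} → cubeFree {p}) , 2∤M))) ¬case)
    , (λ (q , q-prime , q³∣M) → [ id , (λ (q≡2 , _) → contradiction
          (ℕ.∣-trans (ℕ.divides 4 refl) (subst (λ q → q ℕ.^ 3 ℕ.∣ M) q≡2 q³∣M)) 2∤M) ]′
        (cubed⇒wins (n ℕ.* 2) 1<N q-prime
          (subst (q ℕ.^ 3 ℕ.∣_) (sym N≡16M) (ℕ.∣n⇒∣m*n 16 q³∣M))))
    ]′ (cubeFree? M)

∤-odd : ∀ k → ¬ 2 ℕ.∣ suc (k ℕ.* 2)
∤-odd k 2∣ = case ℕ.∣1⇒≡1 (ℕ.∣m+n∣m⇒∣n {m = k ℕ.* 2} {n = 1}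
  (subst (2 ℕ.∣_) (ℕ.+-comm 1 (k ℕ.* 2)) 2∣) (ℕ.divides k refl)) of λ ()

-- For N = 16 N₂, an odd prime is coprime to 16, so its cube would divide N₂; for p = 2,
-- divisibility by 32 would make N₂ even.
cubesDividing : ∀ {N} n → LastPlayerCase (3 ℕ.+ n ℕ.* 2) N →
  ∀ {p} → Prime p → p ℕ.^ 3 ℕ.∣ N → 0 < n × p ≡ 2 × 16 ℕ.∣ N × ¬ 32 ℕ.∣ N
cubesDividing n (inj₁ 2∣d) _ _ = contradiction 2∣d (∤-odd (suc n))
cubesDividing n (inj₂ (inj₁ (_ , cubeFree))) pr p³∣N = contradiction p³∣N (cubeFree pr)
cubesDividing n (inj₂ (inj₂ (3<d , N₂ , refl , cubeFree , 2∤N₂))) {p} pr p³∣N with p ℕ.≟ 2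
... | yes refl = 0<n n 3<d , refl , ℕ.m∣m*n N₂ , 2∤N₂ ∘ ℕ.*-cancelˡ-∣ 16
  where
  0<n : ∀ n → 3 < 3 ℕ.+ n ℕ.* 2 → 0 < n
  0<n zero    3<3 = contradiction 3<3 (ℕ.<-irrefl refl)
  0<n (suc n) _   = s≤s z≤n
... | no p≢2 = contradiction p³∣N₂ (cubeFree pr)
  where
  p∤16 : ¬ + p ∣ + 16
  p∤16 p∣16 = p≢2 (prime∣2 pr (euclid-^ pr (+ 2) 4 p∣16))
  p³∣N₂ : p ℕ.^ 3 ℕ.∣ N₂
  p³∣N₂ = case primePow-inverse pr 3 (+ 16) p∤16 of λ (u , p³∣16u-1) →
    ∣⇒∣ᵤ {+ (p ℕ.^ 3)} {+ N₂} (∣-cancel-inverse (+ 16) u (+ N₂)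
      (subst (_∣ + 16 * u - 1ℤ) (sym (pos-^ p 3)) p³∣16u-1)
      (subst (+ (p ℕ.^ 3) ∣_) (trans (ℤ.pos-* 16 N₂) (ℤ.*-comm (+ 16) (+ N₂))) (∣ᵤ⇒∣ p³∣N)))

-- Assembly by the parity of the degree

composite>2 : ∀ {n} → Composite n → 2 < n
composite>2 {0} comp = contradiction comp ¬composite[0]
composite>2 {1} comp = contradiction comp ¬composite[1]
composite>2 {2} comp = contradiction prime[2] (composite⇒¬prime comp)
composite>2 {suc (suc (suc _))} _ = s≤s (s≤s (s≤s z≤n))

Claim : ℕ → ℕ → Set
Claim d N = let open Game (ℤ/ N ℤ) d in
  (LastPlayerCase d N → (first : Player) → HasWinningStrategy first (lastMover d first))
  × (¬ LastPlayerCase d N → (first : Player) → HasWinningStrategy first wanda)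

claim-even : ∀ {N} k → 1 < N → Composite N → Claim (suc k ℕ.* 2) N
claim-even {N} k 1<N comp =
    (λ _ first → subst (Game.HasWinningStrategy (ℤ/ N ℤ) (suc k ℕ.* 2) first)
                   (sym (mover-even first (suc k))) (firstWins first)) ,
    (λ ¬case → contradiction (inj₁ (ℕ.divides (suc k) refl)) ¬case)
  where
  firstWins : ∀ first → Game.HasWinningStrategy (ℤ/ N ℤ) (suc k ℕ.* 2) first first
  firstWins nora  = noraLast-even k 1<N comp
  firstWins wanda = wandaLast-even k (composite>2 comp)

claim-odd : ∀ {N} k → 1 < N → Composite N → Claim (suc (k ℕ.* 2)) N
claim-odd {N} k 1<N comp =
    (λ lastCase first → subst (Game.HasWinningStrategy (ℤ/ N ℤ) (suc (k ℕ.* 2)) first)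
      (sym (cong opponent (mover-even first k))) (secondWins k lastCase first)) ,
    λ where
      -- In odd degree the second player moves last, so here Wanda does.
      ¬case nora  → wandaLast-odd k (composite>2 comp)
      ¬case wanda → wandaFirst-odd k 1<N ¬case
  where
  secondWins : ∀ k → LastPlayerCase (suc (k ℕ.* 2)) N → ∀ first →
               Game.HasWinningStrategy (ℤ/ N ℤ) (suc (k ℕ.* 2)) first (opponent first)
  secondWins k       lastCase nora = wandaLast-odd k (composite>2 comp)
  -- Degree 1 falls under none of the three cases.
  secondWins zero    (inj₁ 2∣1) wanda = contradiction 2∣1 (∤-odd 0)
  secondWins zero    (inj₂ (inj₁ (s≤s () , _))) wanda
  secondWins zero    (inj₂ (inj₂ (s≤s () , _))) wanda
  secondWins (suc n) lastCase wanda = noraLast-odd n 1<N comp (cubesDividing n lastCase)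

theorem1 : (d N : ℕ) → 1 ≤ d → 1 < N → Composite N →
    let open Game (ℤ/ N ℤ) d in
    (LastPlayerCase d N → (first : Player) → HasWinningStrategy first (lastMover d first))
    × (¬ LastPlayerCase d N → (first : Player) → HasWinningStrategy first wanda)
theorem1 d N 1≤d 1<N comp =
  [ (λ where
      (zero  , e) → contradiction e (ℕ.m<n⇒n≢0 1≤d)
      (suc k , e) → subst (λ d → Claim d N) (sym e) (claim-even k 1<N comp))
  , (λ (k , e) → subst (λ d → Claim d N) (sym e) (claim-odd k 1<N comp))
  ]′ (halve d)
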